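{- The class of $(S_{1,2,2},K_3)$-free graphs has bounded clique-width. That is, there is a constant $k$ such that every graph $G$ containing no induced subgraph isomorphic to $S_{1,2,2}$ and no induced subgraph isomorphic to $K_3$ satisfies $cw(G)\le k$.
   Context: All graphs are finite, simple and undirected. For a set $\mathcal{H}$ of graphs, a graph is $\mathcal{H}$-free if it has no induced subgraph isomorphic to a member of $\mathcal{H}$. $K_3$ (the triangle) is the complete graph on three vertices. $S_{1,2,2}$ is the graph with six vertices $u,x_1,y_1,y_2,z_1,z_2$ and exactly the edges $ux_1,\ uy_1,\ y_1y_2,\ uz_1,\ z_1z_2$. The clique-width $cw(G)$ of a graph $G$ is the minimum number of labels needed to construct $G$ using the following four operations on vertex-labeled graphs: (i) creating a new vertex with an (integer) label; (ii) taking the disjoint union of two vertex-labeled, vertex-disjoint graphs; (iii) for two labels $i\ne j$, adding all edges between the set of all vertices with label $i$ and the set of all vertices with label $j$; (iv) renaming label $i$ to label $j$. A class of graphs has bounded clique-width if there is a constant $k$ with $cw(G)\le k$ for all $G$ in the class. -}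

module Defs where

open import Data.Bool.Base using (if_then_else_)
open import Data.Empty using (⊥; ⊥-elim)
open import Data.Fin.Base using (Fin; zero; suc; toℕ; fromℕ<; combine; remQuot; finToFun; funToFin)
open import Data.Fin.Patterns
open import Data.Fin.Properties using (_≟_; any?; all?; toℕ-injective; toℕ-fromℕ<; toℕ<n;
  suc-injective; remQuot-combine; finToFun-funToFin)
open import Data.Fin.Subset as Subset using (Subset; ⁅_⁆)
open import Data.Fin.Subset.Induction using (⊃-wellFounded)
open import Data.Fin.Subset.Properties as Subsetₚ using (_∈?_; x∈⁅x⁆; x∈⁅y⁆⇒x≡y; x∈p∪q⁻; p⊆p∪q; q⊆p∪q)
open import Data.List.Base using (List; []; _∷_; filter; cartesianProduct; allFin)
open import Data.List.Membership.Propositional using (_∈_)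
open import Data.List.Membership.Propositional.Properties using (∈-filter⁺; ∈-filter⁻;
  ∈-cartesianProduct⁺; ∈-allFin)
import Data.List.Membership.DecPropositional as DecMembership
open import Data.List.Relation.Unary.All as All using (All; []; _∷_)
open import Data.List.Relation.Unary.All.Properties using (all-filter)
open import Data.List.Relation.Unary.Any using (here; there)
open import Data.Nat.Base using (ℕ; zero; suc; _≤_; _<_; _^_; _*_; z≤n; s≤s)
import Data.Nat.Properties as ℕ
open import Data.Product.Base using (∃; ∃₂; _×_; _,_; proj₁; proj₂; uncurry)
open import Data.Product.Properties using (≡-dec)
open import Data.Sum.Base as Sum using (_⊎_; inj₁; inj₂; [_,_]′)
open import Data.Sum.Properties using (inj₁-injective; inj₂-injective)
open import Data.Sum.Relation.Binary.Pointwise using (Pointwise; inj₁; inj₂)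
open import Data.Unit.Base using (⊤; tt)
open import Function.Base using (_∘_; case_of_)
open import Function.Bundles using (_⇔_; _↔_; mk⇔; mk↔ₛ′; module Equivalence; module Inverse)
open import Function.Definitions using (Injective)
open import Induction.WellFounded using (Acc; acc)
open import Level using (0ℓ; _⊔_) renaming (suc to lsuc)
open import Relation.Binary.Core using (Rel)
open import Relation.Binary.Definitions using (Symmetric; Irreflexive) renaming (Decidable to Decidable₂)
open import Relation.Binary.PropositionalEquality using (_≡_; _≢_; refl; sym; trans; cong; subst; ≢-sym)
open import Relation.Nullary using (¬_; Dec; yes; no; does; contradiction; _×-dec_; _⊎-dec_; _→-dec_; ¬?)
open import Relation.Nullary.Decidable using (map′; dec-true; dec-false)
open import Relation.Unary using (Pred; Decidable)

------------------------------------------------------------------------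
-- Graphs

record Graph : Set₁ where
  field
    order  : ℕ
    Adj    : Rel (Fin order) 0ℓ
    adj?   : Decidable₂ Adj
    symm   : Symmetric Adj
    irrefl : Irreflexive _≡_ Adj

  Vertex : Set
  Vertex = Fin order

open Graph using (order)

-- H ⊴ G : some induced subgraph of G is isomorphic to H, the isomorphism
-- being given as an embedding whose image is the induced subgraph.

infix 4 _⊴_

record _⊴_ (H G : Graph) : Set where
  private
    module H = Graph H
    module G = Graph G
  field
    embed     : H.Vertex → G.Vertex
    injective : Injective _≡_ _≡_ embed
    adjacency : ∀ u v → H.Adj u v ⇔ G.Adj (embed u) (embed v)

infix 5 _-Free

_-Free : ∀ {ℓ} → Pred Graph ℓ → Pred Graph (lsuc 0ℓ ⊔ ℓ)
(ℋ -Free) G = ∀ H → ℋ H → ¬ (H ⊴ G)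

K : ℕ → Graph
K n = record
  { order  = n
  ; Adj    = _≢_
  ; adj?   = λ u v → ¬? (u ≟ v)
  ; symm   = ≢-sym
  ; irrefl = λ eq neq → neq eq
  }

module _ {n : ℕ} where

  open DecMembership (≡-dec (_≟_ {n}) (_≟_ {n})) using () renaming (_∈?_ to _∈ₗ?_)

  Listed : List (Fin n × Fin n) → Rel (Fin n) 0ℓ
  Listed es u v = (u , v) ∈ es ⊎ (v , u) ∈ es

  listed? : ∀ es → Decidable₂ (Listed es)
  listed? es u v = ((u , v) ∈ₗ? es) ⊎-dec ((v , u) ∈ₗ? es)

  fromEdges : (es : List (Fin n × Fin n)) → All (uncurry _≢_) es → Graph
  fromEdges es loopless = record
    { order  = n
    ; Adj    = Listed es
    ; adj?   = listed? es
    ; symm   = Sum.swap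
    ; irrefl = λ { refl → [ (λ m → All.lookup loopless m refl)
                          , (λ m → All.lookup loopless m refl) ]′ }
    }

K₃ : Graph
K₃ = K 3

S₁₂₂ : Graph
S₁₂₂ = fromEdges
  ((u , x₁) ∷ (u , y₁) ∷ (y₁ , y₂) ∷ (u , z₁) ∷ (z₁ , z₂) ∷ [])
  ((λ ()) ∷ (λ ()) ∷ (λ ()) ∷ (λ ()) ∷ (λ ()) ∷ [])
  where
  u x₁ y₁ y₂ z₁ z₂ : Fin 6
  u = 0F ; x₁ = 1F ; y₁ = 2F ; y₂ = 3F ; z₁ = 4F ; z₂ = 5F

------------------------------------------------------------------------
-- Clique-width

record LabelledGraph (k : ℕ) : Set₁ where
  field
    Vertex : Set
    Adj    : Rel Vertex 0ℓ
    label  : Vertex → Fin k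

data Expression (k : ℕ) : Set where
  vertex : Fin k → Expression k
  _⊕_    : Expression k → Expression k → Expression k
  join   : (i j : Fin k) → i ≢ j → Expression k → Expression k
  rename : (i j : Fin k) → Expression k → Expression k

relabel : ∀ {k} → Fin k → Fin k → Fin k → Fin k
relabel i j l = if does (l ≟ i) then j else l

⟦_⟧ : ∀ {k} → Expression k → LabelledGraph k
⟦ vertex i ⟧ = record
  { Vertex = ⊤ ; Adj = λ _ _ → ⊥ ; label = λ _ → i }
⟦ e₁ ⊕ e₂ ⟧ = record
  { Vertex = G₁.Vertex ⊎ G₂.Vertex
  ; Adj    = Pointwise G₁.Adj G₂.Adj
  ; label  = [ G₁.label , G₂.label ]′
  }
  where
  module G₁ = LabelledGraph ⟦ e₁ ⟧
  module G₂ = LabelledGraph ⟦ e₂ ⟧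
⟦ join i j _ e ⟧ = record
  { Vertex = G.Vertex
  ; Adj    = λ v w → G.Adj v w ⊎ (G.label v ≡ i × G.label w ≡ j)
                               ⊎ (G.label v ≡ j × G.label w ≡ i)
  ; label  = G.label
  }
  where module G = LabelledGraph ⟦ e ⟧
⟦ rename i j e ⟧ = record
  { Vertex = G.Vertex ; Adj = G.Adj ; label = relabel i j ∘ G.label }
  where module G = LabelledGraph ⟦ e ⟧

record _≅_ {k} (G : Graph) (L : LabelledGraph k) : Set where
  private
    module G = Graph G
    module L = LabelledGraph L
  field
    vertices  : G.Vertex ↔ L.Vertex
    adjacency : ∀ u v → G.Adj u v ⇔ L.Adj (Inverse.to vertices u) (Inverse.to vertices v)

-- An expression always denotes a graph with at least one vertex. The graph
-- without vertices needs no operation, hence no label: its clique-width is 0.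

Constructible : Graph → ℕ → Set
Constructible G k = order G ≡ 0 ⊎ ∃ λ (e : Expression k) → G ≅ ⟦ e ⟧

IsMinimum : Pred ℕ 0ℓ → Pred ℕ 0ℓ
IsMinimum P c = P c × (∀ k → P k → c ≤ k)

------------------------------------------------------------------------
-- The minimum exists: Constructible G k is decidable, and holds for k = order G.

private

  module _ {n k : ℕ} where

    Labelling : Set
    Labelling = Fin n → Fin (suc k)

    -- The graph denoted by e, laid out in Fin n along f: label l is recorded
    -- as suc l, and zero marks the points outside the image of f.

    record Realises (e : Expression k) (f : LabelledGraph.Vertex ⟦ e ⟧ → Fin n)
                    (lab : Labelling) (E : Rel (Fin n) 0ℓ) : Set where
      private module G = LabelledGraph ⟦ e ⟧
      field
        inj  : Injective _≡_ _≡_ f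
        labs : ∀ w → lab (f w) ≡ suc (G.label w)
        onto : ∀ v → lab v ≢ zero → ∃ λ w → f w ≡ v
        adj⁺ : ∀ {w w′} → G.Adj w w′ → E (f w) (f w′)
        adj⁻ : ∀ {a b} → E a b → ∃₂ λ w w′ → f w ≡ a × f w′ ≡ b × G.Adj w w′

    open Realises

    _≈_ : Rel (Labelling × Rel (Fin n) 0ℓ) 0ℓ
    (lab , E) ≈ (lab′ , E′) =
      (∀ v → lab v ≡ lab′ v) × (∀ a b → (E a b → E′ a b) × (E′ a b → E a b))

    resp : ∀ {e f lab E lab′ E′} → (lab , E) ≈ (lab′ , E′) →
           Realises e f lab E → Realises e f lab′ E′
    resp (l , h) r = record
      { inj  = inj r
      ; labs = λ w → trans (sym (l _)) (labs r w)
      ; onto = λ v nz → onto r v (λ z → nz (trans (sym (l v)) z))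
      ; adj⁺ = λ a → proj₁ (h _ _) (adj⁺ r a)
      ; adj⁻ = λ a → adj⁻ r (proj₂ (h _ _) a)
      }

    ≈-sym : ∀ {x y} → x ≈ y → y ≈ x
    ≈-sym (l , h) = (λ v → sym (l v)) , λ a b → proj₂ (h a b) , proj₁ (h a b)

    pointLab : Fin k → Fin n → Labelling
    pointLab i v w = if does (w ≟ v) then suc i else zero

    noEdge : Rel (Fin n) 0ℓ
    noEdge _ _ = ⊥

    mergeLab : Labelling → Labelling → Labelling
    mergeLab l l′ v with l v
    ... | zero  = l′ v
    ... | suc i = suc i

    Disjoint : Rel Labelling 0ℓ
    Disjoint l l′ = ∀ v → l v ≡ zero ⊎ l′ v ≡ zero

    unionE : Rel (Fin n) 0ℓ → Rel (Fin n) 0ℓ → Rel (Fin n) 0ℓ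
    unionE E E′ a b = E a b ⊎ E′ a b

    joinE : Fin k → Fin k → Labelling → Rel (Fin n) 0ℓ → Rel (Fin n) 0ℓ
    joinE i j l E a b = E a b ⊎ (l a ≡ suc i × l b ≡ suc j) ⊎ (l a ≡ suc j × l b ≡ suc i)

    renameLab : Fin k → Fin k → Labelling → Labelling
    renameLab i j l v with l v
    ... | zero  = zero
    ... | suc m = suc (relabel i j m)

    pointLab-same : ∀ i v → pointLab i v v ≡ suc i
    pointLab-same i v rewrite dec-true (v ≟ v) refl = refl

    realise-vertex : ∀ i (f : ⊤ → Fin n) → Realises (vertex i) f (pointLab i (f tt)) noEdge
    realise-vertex i f = record
      { inj  = λ _ → refl
      ; labs = λ _ → pointLab-same i (f tt)
      ; onto = covered
      ; adj⁺ = λ ()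
      ; adj⁻ = λ ()
      }
      where
      covered : ∀ v → pointLab i (f tt) v ≢ zero → ∃ λ w → f w ≡ v
      covered v nz with v ≟ f tt
      ... | yes eq = tt , sym eq
      ... | no  _  = contradiction refl nz

    disjoint⇒≢ : ∀ {l l′ : Labelling} {v i j} → Disjoint l l′ → l v ≡ suc i → l′ v ≡ suc j → ⊥
    disjoint⇒≢ {v = v} d p q with d v
    ... | inj₁ z = case trans (sym p) z of λ ()
    ... | inj₂ z = case trans (sym q) z of λ ()

    mergeLab-left : ∀ l l′ {v i} → l v ≡ suc i → mergeLab l l′ v ≡ suc i
    mergeLab-left l l′ {v} eq with l v
    mergeLab-left l l′ refl | suc i = refl

    mergeLab-right : ∀ l l′ {v} → l v ≡ zero → mergeLab l l′ v ≡ l′ v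
    mergeLab-right l l′ {v} eq with l v
    mergeLab-right l l′ refl | zero = refl

    realise-⊕ : ∀ {e e′ l l′ E E′} (h : LabelledGraph.Vertex ⟦ e ⊕ e′ ⟧ → Fin n) →
                Realises e (h ∘ inj₁) l E → Realises e′ (h ∘ inj₂) l′ E′ → Disjoint l l′ →
                Realises (e ⊕ e′) h (mergeLab l l′) (unionE E E′)
    realise-⊕ {e} {e′} {l} {l′} {E} {E′} h r r′ d = record
      { inj = inj⊕ ; labs = labs⊕ ; onto = onto⊕ ; adj⁺ = adj⁺⊕ ; adj⁻ = adj⁻⊕ }
      where
      module G = LabelledGraph ⟦ e ⊕ e′ ⟧

      inj⊕ : Injective _≡_ _≡_ h
      inj⊕ {inj₁ a} {inj₁ b} eq = cong inj₁ (inj r eq)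
      inj⊕ {inj₂ a} {inj₂ b} eq = cong inj₂ (inj r′ eq)
      inj⊕ {inj₁ a} {inj₂ b} eq =
        ⊥-elim (disjoint⇒≢ {l} {l′} d (trans (cong l (sym eq)) (labs r a)) (labs r′ b))
      inj⊕ {inj₂ a} {inj₁ b} eq =
        ⊥-elim (disjoint⇒≢ {l} {l′} d (trans (cong l eq) (labs r b)) (labs r′ a))

      labs⊕ : ∀ w → mergeLab l l′ (h w) ≡ suc (G.label w)
      labs⊕ (inj₁ a) = mergeLab-left l l′ (labs r a)
      labs⊕ (inj₂ b) with d (h (inj₂ b))
      ... | inj₁ z = trans (mergeLab-right l l′ z) (labs r′ b)
      ... | inj₂ z = case trans (sym (labs r′ b)) z of λ ()

      onto⊕ : ∀ v → mergeLab l l′ v ≢ zero → ∃ λ w → h w ≡ v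
      onto⊕ v nz with l v ≟ zero
      ... | no  nz′ = let w , eq = onto r v nz′ in inj₁ w , eq
      ... | yes z   =
        let w , eq = onto r′ v (nz ∘ trans (mergeLab-right l l′ z)) in inj₂ w , eq

      adj⁺⊕ : ∀ {w w′} → G.Adj w w′ → unionE E E′ (h w) (h w′)
      adj⁺⊕ (inj₁ a) = inj₁ (adj⁺ r a)
      adj⁺⊕ (inj₂ a) = inj₂ (adj⁺ r′ a)

      adj⁻⊕ : ∀ {a b} → unionE E E′ a b → ∃₂ λ w w′ → h w ≡ a × h w′ ≡ b × G.Adj w w′
      adj⁻⊕ (inj₁ x) = let w , w′ , p , q , a = adj⁻ r x in inj₁ w , inj₁ w′ , p , q , inj₁ a
      adj⁻⊕ (inj₂ x) = let w , w′ , p , q , a = adj⁻ r′ x in inj₂ w , inj₂ w′ , p , q , inj₂ a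

    realise-join : ∀ {e f l E} i j i≢j → Realises e f l E →
                   Realises (join i j i≢j e) f l (joinE i j l E)
    realise-join {e} {f} {l} {E} i j i≢j r = record
      { inj = inj r ; labs = labs r ; onto = onto r ; adj⁺ = adj⁺J ; adj⁻ = adj⁻J }
      where
      module G = LabelledGraph ⟦ join i j i≢j e ⟧

      to : ∀ {w m} → G.label w ≡ m → l (f w) ≡ suc m
      to {w} eq = trans (labs r w) (cong suc eq)

      point : ∀ {v m} → l v ≡ suc m → ∃ λ w → f w ≡ v × G.label w ≡ m
      point {v} eq with onto r v (λ z → case trans (sym eq) z of λ ())
      ... | w , refl = w , refl , suc-injective (trans (sym (labs r w)) eq)

      adj⁺J : ∀ {w w′} → G.Adj w w′ → joinE i j l E (f w) (f w′)
      adj⁺J (inj₁ a)              = inj₁ (adj⁺ r a)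
      adj⁺J (inj₂ (inj₁ (p , q))) = inj₂ (inj₁ (to p , to q))
      adj⁺J (inj₂ (inj₂ (p , q))) = inj₂ (inj₂ (to p , to q))

      adj⁻J : ∀ {a b} → joinE i j l E a b → ∃₂ λ w w′ → f w ≡ a × f w′ ≡ b × G.Adj w w′
      adj⁻J (inj₁ x) = let w , w′ , p , q , a = adj⁻ r x in w , w′ , p , q , inj₁ a
      adj⁻J (inj₂ (inj₁ (x , y))) =
        let w , p , p′ = point x ; w′ , q , q′ = point y in w , w′ , p , q , inj₂ (inj₁ (p′ , q′))
      adj⁻J (inj₂ (inj₂ (x , y))) =
        let w , p , p′ = point x ; w′ , q , q′ = point y in w , w′ , p , q , inj₂ (inj₂ (p′ , q′))

    renameLab-suc : ∀ i j l {v m} → l v ≡ suc m → renameLab i j l v ≡ suc (relabel i j m)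
    renameLab-suc i j l {v} eq with l v
    renameLab-suc i j l refl | suc m = refl

    renameLab-zero : ∀ i j l {v} → l v ≡ zero → renameLab i j l v ≡ zero
    renameLab-zero i j l {v} eq with l v
    renameLab-zero i j l refl | zero = refl

    realise-rename : ∀ {e f l E} i j → Realises e f l E →
                     Realises (rename i j e) f (renameLab i j l) E
    realise-rename {l = l} i j r = record
      { inj  = inj r
      ; labs = λ w → renameLab-suc i j l (labs r w)
      ; onto = λ v nz → onto r v (nz ∘ renameLab-zero i j l)
      ; adj⁺ = adj⁺ r
      ; adj⁻ = adj⁻ r
      }

    -- Layouts up to ≈ are finite in number: they are coded by Fin size.

    size : ℕ
    size = (suc k ^ n) * ((2 ^ n) ^ n)

    labOf : Fin size → Labelling
    labOf x = finToFun (proj₁ (remQuot ((2 ^ n) ^ n) x))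

    bit : Fin size → Fin n → Fin n → Fin 2
    bit x a b = finToFun (finToFun {2 ^ n} (proj₂ (remQuot {suc k ^ n} ((2 ^ n) ^ n) x)) a) b

    edgeOf : Fin size → Rel (Fin n) 0ℓ
    edgeOf x a b = bit x a b ≡ 1F

    ⟪_⟫ : Fin size → Labelling × Rel (Fin n) 0ℓ
    ⟪ x ⟫ = labOf x , edgeOf x

    encode : ∀ l {E} → Decidable₂ E → ∃ λ x → ⟪ x ⟫ ≈ (l , E)
    encode l {E} E? = x , labs≡ , λ a b → edges⁺ a b , edges⁻ a b
      where
      β : Fin n → Fin n → Fin 2
      β a b = if does (E? a b) then 1F else 0F

      x : Fin size
      x = combine (funToFin l) (funToFin (funToFin ∘ β))

      labs≡ : ∀ v → labOf x v ≡ l v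
      labs≡ v = trans
        (cong (λ q → finToFun (proj₁ q) v)
              (remQuot-combine (funToFin l) (funToFin (funToFin ∘ β))))
        (finToFun-funToFin l v)

      bit≡ : ∀ a b → bit x a b ≡ β a b
      bit≡ a b = trans
        (cong (λ q → finToFun (finToFun {2 ^ n} (proj₂ q) a) b)
              (remQuot-combine (funToFin l) (funToFin (funToFin ∘ β))))
        (trans (cong (λ q → finToFun q b) (finToFun-funToFin (funToFin ∘ β) a))
               (finToFun-funToFin (β a) b))

      β⁻ : ∀ a b → β a b ≡ 1F → E a b
      β⁻ a b eq with E? a b
      β⁻ a b eq | yes e = e
      β⁻ a b () | no _

      edges⁺ : ∀ a b → edgeOf x a b → E a b
      edges⁺ a b e = β⁻ a b (trans (sym (bit≡ a b)) e)

      edges⁻ : ∀ a b → E a b → edgeOf x a b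
      edges⁻ a b e = trans (bit≡ a b)
        (cong (if_then 1F else 0F) (dec-true (E? a b) e))

    edgeOf? : ∀ x → Decidable₂ (edgeOf x)
    edgeOf? x a b = bit x a b ≟ 1F

    unionE? : ∀ {E E′} → Decidable₂ E → Decidable₂ E′ → Decidable₂ (unionE E E′)
    unionE? E? E′? a b = E? a b ⊎-dec E′? a b

    joinE? : ∀ i j l {E} → Decidable₂ E → Decidable₂ (joinE i j l E)
    joinE? i j l E? a b = E? a b ⊎-dec
      ((l a ≟ suc i ×-dec l b ≟ suc j) ⊎-dec (l a ≟ suc j ×-dec l b ≟ suc i))

    noEdge? : Decidable₂ noEdge
    noEdge? _ _ = no λ ()

    ≈-dec : ∀ {l l′ E E′} → Decidable₂ E → Decidable₂ E′ → Dec ((l , E) ≈ (l′ , E′))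
    ≈-dec {l} {l′} E? E′? = all? (λ v → l v ≟ l′ v) ×-dec all? λ a → all? λ b →
      (E? a b →-dec E′? a b) ×-dec (E′? a b →-dec E? a b)

    data Step (p : Subset size) (x : Fin size) : Set where
      vertex : ∀ i v → ⟪ x ⟫ ≈ (pointLab i v , noEdge) → Step p x
      union  : ∀ s t → s Subset.∈ p → t Subset.∈ p → Disjoint (labOf s) (labOf t) →
               ⟪ x ⟫ ≈ (mergeLab (labOf s) (labOf t) , unionE (edgeOf s) (edgeOf t)) → Step p x
      join   : ∀ s i j → s Subset.∈ p → i ≢ j →
               ⟪ x ⟫ ≈ (labOf s , joinE i j (labOf s) (edgeOf s)) → Step p x
      rename : ∀ s i j → s Subset.∈ p →
               ⟪ x ⟫ ≈ (renameLab i j (labOf s) , edgeOf s) → Step p x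

    step? : ∀ p → Decidable (Step p)
    step? p x = map′
      (λ { (inj₁ (i , v , q))                              → vertex i v q
         ; (inj₂ (inj₁ (s , t , a , b , d , q)))           → union s t a b d q
         ; (inj₂ (inj₂ (inj₁ (s , i , j , a , i≢j , q)))) → join s i j a i≢j q
         ; (inj₂ (inj₂ (inj₂ (s , i , j , a , q))))        → rename s i j a q })
      (λ { (vertex i v q)       → inj₁ (i , v , q)
         ; (union s t a b d q)  → inj₂ (inj₁ (s , t , a , b , d , q))
         ; (join s i j a i≢j q) → inj₂ (inj₂ (inj₁ (s , i , j , a , i≢j , q)))
         ; (rename s i j a q)   → inj₂ (inj₂ (inj₂ (s , i , j , a , q))) })
      (any? (λ i → any? λ v → ≈-dec (edgeOf? x) noEdge?)
       ⊎-dec any? (λ s → any? λ t → s ∈? p ×-dec t ∈? p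
         ×-dec all? (λ v → labOf s v ≟ zero ⊎-dec labOf t v ≟ zero)
         ×-dec ≈-dec (edgeOf? x) (unionE? (edgeOf? s) (edgeOf? t)))
       ⊎-dec any? (λ s → any? λ i → any? λ j → s ∈? p ×-dec ¬? (i ≟ j)
         ×-dec ≈-dec (edgeOf? x) (joinE? i j (labOf s) (edgeOf? s)))
       ⊎-dec any? (λ s → any? λ i → any? λ j → s ∈? p
         ×-dec ≈-dec (edgeOf? x) (edgeOf? s)))

    Realisable : Fin size → Set
    Realisable x = ∃₂ λ e f → Realises e f (labOf x) (edgeOf x)

    Sound Closed : Subset size → Set
    Sound p  = ∀ {x} → x Subset.∈ p → Realisable x
    Closed p = ∀ {x} → Step p x → x Subset.∈ p

    step-sound : ∀ {p x} → Sound p → Step p x → Realisable x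
    step-sound snd (vertex i v q) =
      vertex i , (λ _ → v) , resp (≈-sym q) (realise-vertex i (λ _ → v))
    step-sound snd (union s t a b d q) =
      let e , f , r = snd a ; e′ , f′ , r′ = snd b in
      e ⊕ e′ , [ f , f′ ]′ , resp (≈-sym q) (realise-⊕ [ f , f′ ]′ r r′ d)
    step-sound snd (join s i j a i≢j q) =
      let e , f , r = snd a in join i j i≢j e , f , resp (≈-sym q) (realise-join i j i≢j r)
    step-sound snd (rename s i j a q) =
      let e , f , r = snd a in rename i j e , f , resp (≈-sym q) (realise-rename i j r)

    saturate : ∀ p → Acc Subset._⊃_ p → Sound p → ∃ λ q → Sound q × Closed q
    saturate p (acc rec) snd with any? (λ x → ¬? (x ∈? p) ×-dec step? p x)
    ... | no none = p , snd , closed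
      where
      closed : Closed p
      closed {x} st with x ∈? p
      ... | yes x∈p = x∈p
      ... | no  x∉p = contradiction (x , x∉p , st) none
    ... | yes (x , x∉p , st) =
      saturate (p Subset.∪ ⁅ x ⁆)
        (rec (p⊆p∪q ⁅ x ⁆ , x , q⊆p∪q p ⁅ x ⁆ (x∈⁅x⁆ x) , x∉p)) snd′
      where
      snd′ : Sound (p Subset.∪ ⁅ x ⁆)
      snd′ {y} y∈ with x∈p∪q⁻ p ⁅ x ⁆ y∈
      ... | inj₁ y∈p = snd y∈p
      ... | inj₂ y∈x with refl ← x∈⁅y⁆⇒x≡y x y∈x = step-sound snd st

    saturation : ∃ λ q → Sound q × Closed q
    saturation = saturate Subset.⊥ (⊃-wellFounded _) (λ x∈ → contradiction x∈ Subsetₚ.∉⊥)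

    complete : ∀ {q} → Closed q → ∀ e f → Injective _≡_ _≡_ f →
               ∃ λ x → x Subset.∈ q × Realises e f (labOf x) (edgeOf x)
    complete cl (vertex i) f f-inj =
      let x , eq = encode (pointLab i (f tt)) noEdge? in
      x , cl (vertex i (f tt) eq) , resp (≈-sym eq) (realise-vertex i f)
    complete cl (e ⊕ e′) f f-inj =
      let s , s∈ , r  = complete cl e  (f ∘ inj₁) (inj₁-injective ∘ f-inj)
          t , t∈ , r′ = complete cl e′ (f ∘ inj₂) (inj₂-injective ∘ f-inj)
          d           = disjoint r r′
          x , eq      = encode (mergeLab (labOf s) (labOf t)) (unionE? (edgeOf? s) (edgeOf? t))
      in x , cl (union s t s∈ t∈ d eq) , resp (≈-sym eq) (realise-⊕ f r r′ d)
      where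
      disjoint : ∀ {l l′ E E′} → Realises e (f ∘ inj₁) l E → Realises e′ (f ∘ inj₂) l′ E′ →
                 Disjoint l l′
      disjoint {l} {l′} r r′ v with l v ≟ zero | l′ v ≟ zero
      ... | yes z | _      = inj₁ z
      ... | _     | yes z  = inj₂ z
      ... | no nz | no nz′ with onto r v nz | onto r′ v nz′
      ...   | w , refl | w′ , eq = case f-inj eq of λ ()
    complete cl (join i j i≢j e) f f-inj =
      let s , s∈ , r = complete cl e f f-inj
          x , eq     = encode (labOf s) (joinE? i j (labOf s) (edgeOf? s))
      in x , cl (join s i j s∈ i≢j eq) , resp (≈-sym eq) (realise-join i j i≢j r)
    complete cl (rename i j e) f f-inj =
      let s , s∈ , r = complete cl e f f-inj
          x , eq     = encode (renameLab i j (labOf s)) (edgeOf? s)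
      in x , cl (rename s i j s∈ eq) , resp (≈-sym eq) (realise-rename i j r)

  module _ (G : Graph) where

    open Graph G using (Adj; adj?; symm; irrefl) renaming (order to n)

    realised⇒≅ : ∀ {k e f} {l : Labelling {n} {k}} → (∀ v → l v ≢ zero) → Realises e f l Adj → G ≅ ⟦ e ⟧
    realised⇒≅ {e = e} {f} full r = record
      { vertices  = mk↔ₛ′ g f (λ w → inj (f-g (f w))) f-g
      ; adjacency = λ u v → mk⇔ to (λ a → subst₂′ (f-g u) (f-g v) (adj⁺ a))
      }
      where
      open Realises r
      module L = LabelledGraph ⟦ e ⟧

      g : Fin n → L.Vertex
      g v = proj₁ (onto v (full v))

      f-g : ∀ v → f (g v) ≡ v
      f-g v = proj₂ (onto v (full v))

      subst₂′ : ∀ {a b c d} → a ≡ c → b ≡ d → Adj a b → Adj c d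
      subst₂′ refl refl x = x

      to : ∀ {u v} → Adj u v → L.Adj (g u) (g v)
      to {u} {v} a with adj⁻ a
      ... | w , w′ , refl , refl , x
        rewrite inj (f-g (f w)) | inj (f-g (f w′)) = x

    constructible? : ∀ k → Dec (Constructible G k)
    constructible? k = (n ℕ.≟ 0) ⊎-dec map′ from to
      (any? λ x → x ∈? q ×-dec all? (λ v → ¬? (labOf x v ≟ zero)) ×-dec
        all? λ a → all? λ b → (edgeOf? x a b →-dec adj? a b) ×-dec (adj? a b →-dec edgeOf? x a b))
      where
      q : Subset (size {n} {k})
      q = proj₁ (saturation {n} {k})

      Found : Fin (size {n} {k}) → Set
      Found x = x Subset.∈ q × (∀ v → labOf x v ≢ zero) ×
        (∀ a b → (edgeOf x a b → Adj a b) × (Adj a b → edgeOf x a b))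

      from : ∃ Found → ∃ λ e → G ≅ ⟦ e ⟧
      from (x , x∈q , full , same) =
        let e , f , r = proj₁ (proj₂ saturation) x∈q in
        e , realised⇒≅ full (resp ((λ _ → refl) , same) r)

      to : (∃ λ e → G ≅ ⟦ e ⟧) → ∃ Found
      to (e , iso) = found (complete (proj₂ (proj₂ saturation)) e f f-inj)
        where
        open _≅_ iso
        open Inverse vertices renaming (to to g; from to f)
        module L = LabelledGraph ⟦ e ⟧

        f-inj : Injective _≡_ _≡_ f
        f-inj {a} {b} eq = trans (sym (strictlyInverseˡ a)) (trans (cong g eq) (strictlyInverseˡ b))

        found : (∃ λ x → x Subset.∈ q × Realises e f (labOf x) (edgeOf x)) → ∃ Found
        found (x , x∈q , r) = x , x∈q , full , λ a b → e⇒a a b , a⇒e a b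
          where
          open Realises r

          full : ∀ v → labOf x v ≢ zero
          full v z with trans (sym (labs (g v))) (trans (cong (labOf x) (strictlyInverseʳ v)) z)
          ... | ()

          e⇒a : ∀ a b → edgeOf x a b → Adj a b
          e⇒a a b h with adj⁻ h
          ... | w , w′ , refl , refl , y = Equivalence.from (adjacency (f w) (f w′))
            (subst (λ u → L.Adj u (g (f w′))) (sym (strictlyInverseˡ w))
              (subst (L.Adj w) (sym (strictlyInverseˡ w′)) y))

          a⇒e : ∀ a b → Adj a b → edgeOf x a b
          a⇒e a b h = subst (λ u → edgeOf x u b) (strictlyInverseʳ a)
            (subst (edgeOf x (f (g a))) (strictlyInverseʳ b)
              (adj⁺ (Equivalence.to (adjacency a b) h)))

    prefix : ℕ → Labelling {n} {n}
    prefix m v = if does (toℕ v ℕ.<? m) then suc v else zero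

    realise-prefix : ∀ m → suc m ≤ n → ∃₂ λ e f → Realises e f (prefix (suc m)) (noEdge {n} {n})
    realise-prefix zero 0<n = vertex p , (λ _ → p) , resp (same , λ _ _ → (λ ()) , λ ()) (realise-vertex p (λ _ → p))
      where
      p = fromℕ< 0<n
      same : ∀ v → pointLab p p v ≡ prefix 1 v
      same v with v ≟ p
      ... | yes refl rewrite dec-true (toℕ v ℕ.<? 1) (s≤s (ℕ.≤-reflexive (toℕ-fromℕ< 0<n))) = refl
      ... | no  v≢p  rewrite dec-false (toℕ v ℕ.<? 1)
          (λ { (s≤s v≤0) → v≢p (toℕ-injective (trans (ℕ.n≤0⇒n≡0 v≤0) (sym (toℕ-fromℕ< 0<n)))) }) = refl
    realise-prefix (suc m) m<n =
      let e , f , r = realise-prefix m (ℕ.≤-trans (ℕ.n≤1+n _) m<n) in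
      e ⊕ vertex p , [ f , (λ _ → p) ]′ ,
      resp (same , λ _ _ → [ (λ ()) , (λ ()) ]′ , λ ())
        (realise-⊕ [ f , (λ _ → p) ]′ r (realise-vertex p (λ _ → p)) disj)
      where
      p = fromℕ< m<n

      disj : Disjoint (prefix (suc m)) (pointLab p p)
      disj v with v ≟ p
      ... | no  _    = inj₂ refl
      ... | yes refl rewrite dec-false (toℕ v ℕ.<? suc m)
          (λ lt → ℕ.<-irrefl (toℕ-fromℕ< m<n) lt) = inj₁ refl

      same : ∀ v → mergeLab (prefix (suc m)) (pointLab p p) v ≡ prefix (suc (suc m)) v
      same v with toℕ v ℕ.<? suc m
      ... | yes lt = trans
            (mergeLab-left (prefix (suc m)) (pointLab p p) {v} {v}
              (cong (if_then suc v else zero) (dec-true (toℕ v ℕ.<? suc m) lt)))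
            (sym (cong (if_then suc v else zero) (dec-true (toℕ v ℕ.<? suc (suc m)) (ℕ.m≤n⇒m≤1+n lt))))
      ... | no ¬lt = trans
            (mergeLab-right (prefix (suc m)) (pointLab p p) {v}
              (cong (if_then suc v else zero) (dec-false (toℕ v ℕ.<? suc m) ¬lt)))
            last
        where
        last : pointLab p p v ≡ prefix (suc (suc m)) v
        last with v ≟ p
        ... | yes refl = sym (cong (if_then suc v else zero)
                (dec-true (toℕ v ℕ.<? suc (suc m)) (s≤s (ℕ.≤-reflexive (toℕ-fromℕ< m<n)))))
        ... | no  v≢p  = sym (cong (if_then suc v else zero)
                (dec-false (toℕ v ℕ.<? suc (suc m)) λ { (s≤s v≤) →
                  v≢p (toℕ-injective (trans (ℕ.≤-antisym v≤ (ℕ.≮⇒≥ ¬lt)) (sym (toℕ-fromℕ< m<n)))) }))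

    realise-edges : 0 < n → ∀ es → All (uncurry Adj) es →
                    ∃₂ λ e f → Realises {n} {n} e f suc (Listed es)
    realise-edges 0<n [] [] = start n refl
      where
      start : ∀ m → m ≡ n → ∃₂ λ e f → Realises {n} {n} e f suc (Listed [])
      start zero    eq = contradiction 0<n (subst (λ m → ¬ (0 < m)) eq λ ())
      start (suc m) eq =
        let e , f , r = realise-prefix m (ℕ.≤-reflexive eq) in
        e , f , resp (all , λ _ _ → (λ ()) , [ (λ ()) , (λ ()) ]′) r
        where
        all : ∀ v → prefix (suc m) v ≡ suc v
        all v = cong (if_then suc v else zero)
          (dec-true (toℕ v ℕ.<? suc m) (subst (toℕ v <_) (sym eq) (toℕ<n v)))
    realise-edges 0<n ((a , b) ∷ es) (ab ∷ rest) =
      let e , f , r = realise-edges 0<n es rest in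
      join a b a≢b e , f , resp ((λ _ → refl) , λ _ _ → to , from) (realise-join a b a≢b r)
      where
      a≢b : a ≢ b
      a≢b eq = irrefl eq ab

      to : ∀ {c d} → joinE a b suc (Listed es) c d → Listed ((a , b) ∷ es) c d
      to (inj₁ x)                    = Sum.map there there x
      to (inj₂ (inj₁ (refl , refl))) = inj₁ (here refl)
      to (inj₂ (inj₂ (refl , refl))) = inj₂ (here refl)

      from : ∀ {c d} → Listed ((a , b) ∷ es) c d → joinE a b suc (Listed es) c d
      from (inj₁ (here refl)) = inj₂ (inj₁ (refl , refl))
      from (inj₁ (there x))   = inj₁ (inj₁ x)
      from (inj₂ (here refl)) = inj₂ (inj₂ (refl , refl))
      from (inj₂ (there x))   = inj₁ (inj₂ x)

    constructible-order : Constructible G n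
    constructible-order with n ℕ.≟ 0
    ... | yes eq = inj₁ eq
    ... | no  nz =
      let e , f , r = realise-edges (ℕ.n≢0⇒n>0 nz) edges (all-filter adj′? pairs) in
      inj₂ (e , realised⇒≅ (λ _ ()) (resp ((λ _ → refl) , λ a b → to , from) r))
      where
      adj′? : Decidable (uncurry Adj)
      adj′? (a , b) = adj? a b

      pairs edges : List (Fin n × Fin n)
      pairs = cartesianProduct (allFin n) (allFin n)
      edges = filter adj′? pairs

      to : ∀ {a b} → Listed edges a b → Adj a b
      to (inj₁ x) = proj₂ (∈-filter⁻ adj′? {xs = pairs} x)
      to (inj₂ x) = symm (proj₂ (∈-filter⁻ adj′? {xs = pairs} x))

      from : ∀ {a b} → Adj a b → Listed edges a b
      from {a} {b} x = inj₁ (∈-filter⁺ adj′? (∈-cartesianProduct⁺ (∈-allFin a) (∈-allFin b)) x)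

  module _ {P : Pred ℕ 0ℓ} (P? : Decidable P) where

    search : ∀ n → ∃ (IsMinimum P) ⊎ (∀ j → j < n → ¬ P j)
    search zero = inj₂ λ _ ()
    search (suc n) with search n
    ... | inj₁ found = inj₁ found
    ... | inj₂ none with P? n
    ...   | yes p = inj₁ (n , p , λ j pj → ℕ.≮⇒≥ λ j<n → none j j<n pj)
    ...   | no ¬p = inj₂ λ j j<1+n pj → case ℕ.m≤n⇒m<n∨m≡n (ℕ.≤-pred j<1+n) of λ
              { (inj₁ j<n)  → none j j<n pj
              ; (inj₂ refl) → ¬p pj }

    minimum : ∃ P → ∃ (IsMinimum P)
    minimum (n , p) with search (suc n)
    ... | inj₁ found = found
    ... | inj₂ none  = contradiction p (none n ℕ.≤-refl)

abstract

  cliqueWidth : ∀ G → ∃ (IsMinimum (Constructible G))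
  cliqueWidth G = minimum (constructible? G) (order G , constructible-order G)

cw : Graph → ℕ
cw G = proj₁ (cliqueWidth G)

cw-isMinimum : ∀ G → IsMinimum (Constructible G) (cw G)
cw-isMinimum G = proj₂ (cliqueWidth G)

BoundedCliqueWidth : ∀ {ℓ} → Pred Graph ℓ → Set (lsuc 0ℓ ⊔ ℓ)
BoundedCliqueWidth 𝒞 = ∃ λ k → ∀ G → 𝒞 G → cw G ≤ k

{-# OPTIONS --safe #-}

-- Call a set of vertices built when it can be assembled from single vertices by merging disjoint
-- parts with a bounded number of labels, where adjacency across a merge depends on the labels only.
-- A new twin of a vertex can always take that vertex's label, and a graph of maximum degree two is
-- built by following its paths and cycles.
--
-- Suppose that there is a pentagon. A vertex adjacent to the pentagon has no neighbour that is not,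
-- so let every vertex be adjacent to the pentagon. The vertices then fall into five groups of three
-- kinds. Adjacency between two groups depends on the kinds only. Within a group the three bipartite
-- graphs between kinds are chain graphs, and they fit together into an acyclic tournament, so that
-- some vertex is homogeneous to every kind and can be split off.
--
-- Without a pentagon, and in the absence of twins, take a vertex u of degree at least three with
-- inclusionwise maximal neighbourhood A. The traces on A of the vertices at distance two form a
-- cross-free family, which leaves at most one vertex at distance three in the component of u. The
-- graph is then disconnected, or bipartite with a disconnected bipartite complement, and both parts
-- are built by induction with the colour classes as labels.

module Submission where

open import Defs
open import Data.Bool.Base using (Bool; true; false; not)
open import Data.Bool.Properties using (¬-not; not-involutive)
open import Data.Empty using (⊥; ⊥-elim)
open import Data.Fin.Base using (Fin; zero; suc; toℕ; combine; inject₁; _↑ˡ_; _↑ʳ_; splitAt)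
open import Data.Fin.Patterns
open import Data.Fin.Properties using (_≟_; any?; all?; combine-injective; combine-injectiveˡ;
  inject₁-injective; ↑ˡ-injective; ↑ʳ-injective; splitAt-↑ˡ; splitAt-↑ʳ)
open import Data.Fin.Subset using (Subset; Nonempty; _∈_; _∉_; ⁅_⁆; _⊆_; _⊂_; _⊃_)
  renaming (⊤ to full; _∪_ to _∪ˢ_)
open import Data.Fin.Subset.Induction using (⊂-wellFounded; ⊃-wellFounded)
open import Data.Fin.Subset.Properties using (_∈?_; ∈⊤; x∈⁅x⁆; x∈⁅y⁆⇒x≡y; x∈p∪q⁻; p⊆p∪q; q⊆p∪q; ⊆-antisym)
open import Data.List.Base using (List; []; _∷_; filter; cartesianProduct; allFin)
import Data.List.Membership.Propositional as List
open import Data.List.Membership.Propositional.Properties using (∈-filter⁺; ∈-filter⁻;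
  ∈-cartesianProduct⁺; ∈-allFin)
open import Data.List.Relation.Unary.All as All using (All; []; _∷_)
open import Data.List.Relation.Unary.All.Properties using (all-filter)
open import Data.List.Relation.Unary.Any as Any using (here; there)
open import Data.Nat.Base using (ℕ; zero; suc; _+_)
import Data.Nat.Properties as ℕ
open import Data.Product.Base using (∃; ∃₂; _×_; _,_; proj₁; proj₂)
open import Data.Sum.Base as Sum using (_⊎_; inj₁; inj₂; [_,_]′)
import Data.Sum.Relation.Binary.Pointwise as Pointwise
open import Data.Unit.Base using (tt)
open import Data.Vec.Base using ([]; _∷_; lookup; tabulate)
open import Data.Vec.Properties using (lookup∘tabulate; lookup⇒[]=; []=⇒lookup)
open import Function.Base using (_∘_; id; case_of_)
open import Function.Bundles using (mk⇔; mk↔ₛ′)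
open import Induction.WellFounded using (Acc; acc)
open import Level using (0ℓ)
open import Relation.Binary.Core using (Rel)
open import Relation.Binary.PropositionalEquality using (_≡_; _≢_; refl; sym; trans; cong; cong₂; subst)
open import Relation.Nullary using (¬_; Dec; yes; no; does; contradiction; _×-dec_; _⊎-dec_; _→-dec_; ¬?)
open import Relation.Nullary.Decidable using (dec-true; dec-false; toWitness; decidable-stable)
open import Relation.Unary using (Pred; Decidable; ｛_｝; _∪_)

-- Expressions from label-respecting merges

module _ {n : ℕ} {P : Pred (Fin n) 0ℓ} (P? : Decidable P) where

  select : Subset n
  select = tabulate (does ∘ P?)

  ∈-select⁺ : ∀ {x} → P x → x ∈ select
  ∈-select⁺ {x} px = lookup⇒[]= x _ (trans (lookup∘tabulate _ x) (dec-true (P? x) px))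

  ∈-select⁻ : ∀ {x} → x ∈ select → P x
  ∈-select⁻ {x} x∈ with P? x | trans (sym (lookup∘tabulate (does ∘ P?) x)) ([]=⇒lookup x∈)
  ... | yes px | _ = px

record Partition {n} (U S T : Subset n) : Set where
  field
    left⊆    : ∀ {x} → x ∈ S → x ∈ U
    right⊆   : ∀ {x} → x ∈ T → x ∈ U
    cover    : ∀ {x} → x ∈ U → x ∈ S ⊎ x ∈ T
    disjoint : ∀ {x} → x ∈ S → x ∉ T

open Partition

partition-sym : ∀ {n} {U S T : Subset n} → Partition U S T → Partition U T S
partition-sym p = record
  { left⊆    = right⊆ p
  ; right⊆   = left⊆ p
  ; cover    = Sum.swap ∘ cover p
  ; disjoint = λ x∈T x∈S → disjoint p x∈S x∈T
  }

-- A disjoint union supplies the edges inside each part; those running across are added afterwards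
-- by joins.
Within : ∀ {n} → Subset n → Subset n → Rel (Fin n) 0ℓ → Rel (Fin n) 0ℓ
Within S T E a b = E a b × ((a ∈ S × b ∈ S) ⊎ (a ∈ T × b ∈ T))

module _ {n m : ℕ} where

  -- `E` and `l` live on all of `Fin n` but are compared on `S` only, so the parts of a merge can
  -- share one relation and one labelling.
  record Layout (e : Expression m) (S : Subset n) (E : Rel (Fin n) 0ℓ) (l : Fin n → Fin m) : Set where
    private module L = LabelledGraph ⟦ e ⟧
    field
      place     : L.Vertex → Fin n
      injective : ∀ {w w′} → place w ≡ place w′ → w ≡ w′
      inside    : ∀ w → place w ∈ S
      onto      : ∀ {v} → v ∈ S → ∃ λ w → place w ≡ v
      label     : ∀ w → L.label w ≡ l (place w)
      adj⁺      : ∀ {w w′} → L.Adj w w′ → E (place w) (place w′)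
      adj⁻      : ∀ {w w′} → E (place w) (place w′) → L.Adj w w′

  open Layout

  layout-resp : ∀ {e S E E′ l l′} → (∀ {v} → v ∈ S → l v ≡ l′ v) →
                (∀ {a b} → a ∈ S → b ∈ S → E a b → E′ a b) →
                (∀ {a b} → a ∈ S → b ∈ S → E′ a b → E a b) →
                Layout e S E l → Layout e S E′ l′
  layout-resp l≗ to from r = record
    { place     = place r
    ; injective = injective r
    ; inside    = inside r
    ; onto      = onto r
    ; label     = λ w → trans (label r w) (l≗ (inside r w))
    ; adj⁺      = λ a → to (inside r _) (inside r _) (adj⁺ r a)
    ; adj⁻      = λ a → adj⁻ r (from (inside r _) (inside r _) a)
    }

  layout-vertex : ∀ {S E l} v → v ∈ S → (∀ {x} → x ∈ S → x ≡ v) → ¬ E v v → Layout (vertex (l v)) S E l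
  layout-vertex v v∈S only ¬loop = record
    { place     = λ _ → v
    ; injective = λ _ → refl
    ; inside    = λ _ → v∈S
    ; onto      = λ x∈S → tt , sym (only x∈S)
    ; label     = λ _ → refl
    ; adj⁺      = λ ()
    ; adj⁻      = ¬loop
    }

  layout-⊕ : ∀ {e e′ U S T E l} → Partition U S T → Layout e S E l → Layout e′ T E l →
             Layout (e ⊕ e′) U (Within S T E) l
  layout-⊕ {e} {e′} {U} {S} {T} {E} {l} p r r′ = record
    { place = at ; injective = inj _ _ ; inside = in⊕ ; onto = onto⊕
    ; label = label⊕ ; adj⁺ = to ; adj⁻ = from _ _ }
    where
    module L = LabelledGraph ⟦ e ⊕ e′ ⟧

    at : L.Vertex → Fin n
    at = [ place r , place r′ ]′

    apart : ∀ a b → place r a ≢ place r′ b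
    apart a b eq = disjoint p (inside r a) (subst (_∈ T) (sym eq) (inside r′ b))

    inj : ∀ w w′ → at w ≡ at w′ → w ≡ w′
    inj (inj₁ a) (inj₁ b) eq = cong inj₁ (injective r eq)
    inj (inj₁ a) (inj₂ b) eq = ⊥-elim (apart a b eq)
    inj (inj₂ a) (inj₁ b) eq = ⊥-elim (apart b a (sym eq))
    inj (inj₂ a) (inj₂ b) eq = cong inj₂ (injective r′ eq)

    in⊕ : ∀ w → at w ∈ U
    in⊕ (inj₁ a) = left⊆ p (inside r a)
    in⊕ (inj₂ b) = right⊆ p (inside r′ b)

    onto⊕ : ∀ {v} → v ∈ U → ∃ λ w → at w ≡ v
    onto⊕ v∈U with cover p v∈U
    ... | inj₁ v∈S = let w , eq = onto r v∈S in inj₁ w , eq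
    ... | inj₂ v∈T = let w , eq = onto r′ v∈T in inj₂ w , eq

    label⊕ : ∀ w → L.label w ≡ l (at w)
    label⊕ (inj₁ a) = label r a
    label⊕ (inj₂ b) = label r′ b

    to : ∀ {w w′} → L.Adj w w′ → Within S T E (at w) (at w′)
    to (Pointwise.inj₁ a) = adj⁺ r a , inj₁ (inside r _ , inside r _)
    to (Pointwise.inj₂ a) = adj⁺ r′ a , inj₂ (inside r′ _ , inside r′ _)

    from : ∀ w w′ → Within S T E (at w) (at w′) → L.Adj w w′
    from (inj₁ a) (inj₁ b) (h , _)             = Pointwise.inj₁ (adj⁻ r h)
    from (inj₂ a) (inj₂ b) (h , _)             = Pointwise.inj₂ (adj⁻ r′ h)
    from (inj₁ a) (inj₂ b) (_ , inj₁ (_ , b∈S)) = ⊥-elim (disjoint p b∈S (inside r′ b))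
    from (inj₁ a) (inj₂ b) (_ , inj₂ (a∈T , _)) = ⊥-elim (disjoint p (inside r a) a∈T)
    from (inj₂ a) (inj₁ b) (_ , inj₁ (a∈S , _)) = ⊥-elim (disjoint p a∈S (inside r′ a))
    from (inj₂ a) (inj₁ b) (_ , inj₂ (_ , b∈T)) = ⊥-elim (disjoint p (inside r b) b∈T)

  layout-join : ∀ {e S E l} i j i≢j → Layout e S E l →
                Layout (join i j i≢j e) S (λ a b → E a b ⊎ (l a ≡ i × l b ≡ j) ⊎ (l a ≡ j × l b ≡ i)) l
  layout-join i j i≢j r = record
    { place     = place r
    ; injective = injective r
    ; inside    = inside r
    ; onto      = onto r
    ; label     = label r
    ; adj⁺      = Sum.map (adj⁺ r) (Sum.map both both)
    ; adj⁻      = Sum.map (adj⁻ r) (Sum.map both′ both′)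
    }
    where
    both : ∀ {w w′ i j} → _ ≡ i × _ ≡ j → _ ≡ i × _ ≡ j
    both {w} {w′} (p , q) = trans (sym (label r w)) p , trans (sym (label r w′)) q

    both′ : ∀ {w w′ i j} → _ ≡ i × _ ≡ j → _ ≡ i × _ ≡ j
    both′ {w} {w′} (p , q) = trans (label r w) p , trans (label r w′) q

  layout-rename : ∀ {e S E l} i j → Layout e S E l → Layout (rename i j e) S E (relabel i j ∘ l)
  layout-rename i j r = record
    { place     = place r
    ; injective = injective r
    ; inside    = inside r
    ; onto      = onto r
    ; label     = λ w → cong (relabel i j) (label r w)
    ; adj⁺      = adj⁺ r
    ; adj⁻      = adj⁻ r
    }

  module _ {k : ℕ} (src dst : Fin k → Fin m)
           (src-injective : ∀ {i j} → src i ≡ src j → i ≡ j) (dst≢src : ∀ i j → dst j ≢ src i) where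

    renames : List (Fin k) → Expression m → Expression m
    renames []       e = e
    renames (i ∷ is) e = renames is (rename (src i) (dst i) e)

    relabels : List (Fin k) → Fin m → Fin m
    relabels []       x = x
    relabels (i ∷ is) x = relabels is (relabel (src i) (dst i) x)

    layout-renames : ∀ is {e S E l} → Layout e S E l → Layout (renames is e) S E (relabels is ∘ l)
    layout-renames []       r = r
    layout-renames (i ∷ is) r = layout-renames is (layout-rename (src i) (dst i) r)

    relabels-fixed : ∀ is {x} → (∀ i → x ≢ src i) → relabels is x ≡ x
    relabels-fixed []       fixed = refl
    relabels-fixed (i ∷ is) {x} fixed with x ≟ src i
    ... | yes eq = ⊥-elim (fixed i eq)
    ... | no  _  = relabels-fixed is fixed

    relabels-moved : ∀ {is i} → i List.∈ is → relabels is (src i) ≡ dst i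
    relabels-moved {h ∷ is} {i} i∈ with src i ≟ src h
    ... | yes eq rewrite src-injective eq = relabels-fixed is (λ j → dst≢src j h)
    relabels-moved (here refl) | no ne = ⊥-elim (ne refl)
    relabels-moved (there i∈)  | no _  = relabels-moved i∈

    -- The renames run one after another yet act simultaneously: sources are distinct and no target
    -- is a source, so a label once moved stays put.
    layout-shift : ∀ l′ {e S E l} →
      (∀ {v} → v ∈ S → (∃ λ i → l v ≡ src i × l′ v ≡ dst i) ⊎ ((∀ i → l v ≢ src i) × l′ v ≡ l v)) →
      Layout e S E l → ∃ λ e′ → Layout e′ S E l′
    layout-shift l′ {e} {S} {l = l} moves r =
      renames (allFin k) e , layout-resp agree (λ _ _ h → h) (λ _ _ h → h) (layout-renames (allFin k) r)
      where
      agree : ∀ {v} → v ∈ S → relabels (allFin k) (l v) ≡ l′ v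
      agree v∈S with moves v∈S
      ... | inj₁ (i , p , q) rewrite p | q = relabels-moved (∈-allFin i)
      ... | inj₂ (fixed , q) = trans (relabels-fixed (allFin k) fixed) (sym q)

-- Two copies of the `k` labels. Finished expressions use the left copy; the right one tells the
-- parts of a merge apart and serves as a buffer for renaming.
module Tags (k : ℕ) where

  left right : Fin k → Fin (k + k)
  left i  = i ↑ˡ k
  right i = k ↑ʳ i

  left≢right : ∀ i j → left i ≢ right j
  left≢right i j eq with trans (sym (splitAt-↑ˡ k i k)) (trans (cong (splitAt k) eq) (splitAt-↑ʳ k k j))
  ... | ()

  right≢left : ∀ i j → right i ≢ left j
  right≢left i j eq = left≢right j i (sym eq)

module _ {n k : ℕ} where

  open Tags k

  Joined : List (Fin k × Fin k) → (Fin n → Fin (k + k)) → Rel (Fin n) 0ℓ → Rel (Fin n) 0ℓ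
  Joined ps l E a b = E a b ⊎ ∃₂ λ i j → (i , j) List.∈ ps ×
    ((l a ≡ left i × l b ≡ right j) ⊎ (l a ≡ right j × l b ≡ left i))

  layout-joins : ∀ ps {e S E l} → Layout e S E l → ∃ λ e′ → Layout e′ S (Joined ps l E) l
  layout-joins [] {e} r = e , layout-resp (λ _ → refl) (λ _ _ → inj₁)
    (λ _ _ → [ id , (λ { (_ , _ , () , _) }) ]′) r
  layout-joins ((i , j) ∷ ps) {E = E} {l} r
    with e′ , r′ ← layout-joins ps (layout-join (left i) (right j) (left≢right i j) r) =
    e′ , layout-resp (λ _ → refl) (λ _ _ → to) (λ _ _ → from) r′
    where
    E′ : Rel (Fin n) 0ℓ
    E′ a b = E a b ⊎ (l a ≡ left i × l b ≡ right j) ⊎ (l a ≡ right j × l b ≡ left i)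

    to : ∀ {a b} → Joined ps l E′ a b → Joined ((i , j) ∷ ps) l E a b
    to (inj₁ (inj₁ h))            = inj₁ h
    to (inj₁ (inj₂ h))            = inj₂ (i , j , here refl , h)
    to (inj₂ (i′ , j′ , ∈ps , h)) = inj₂ (i′ , j′ , there ∈ps , h)

    from : ∀ {a b} → Joined ((i , j) ∷ ps) l E a b → Joined ps l E′ a b
    from (inj₁ h)                          = inj₁ (inj₁ h)
    from (inj₂ (_ , _ , here refl , h))    = inj₁ (inj₂ h)
    from (inj₂ (i′ , j′ , there ∈ps , h)) = inj₂ (i′ , j′ , ∈ps , h)

-- Built sets and the expressions they yield

module _ (G : Graph) {k : ℕ} where

  open Graph G renaming (order to n)
  open Tags k

  Homogeneous : Subset n → Subset n → (Fin n → Fin k) → Set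
  Homogeneous S T l = ∀ {s s′ t t′} → s ∈ S → s′ ∈ S → t ∈ T → t′ ∈ T →
    l s ≡ l s′ → l t ≡ l t′ → Adj s t → Adj s′ t′

  data Built : Subset n → (Fin n → Fin k) → Set where
    point : ∀ {S l} v → v ∈ S → (∀ {x} → x ∈ S → x ≡ v) → Built S l
    merge : ∀ {U S T l} → Partition U S T → Homogeneous S T l → Built S l → Built T l → Built U l
    coarsen : ∀ {S l l′} → (∀ {x y} → x ∈ S → y ∈ S → l x ≡ l y → l′ x ≡ l′ y) → Built S l → Built S l′

  module _ {U S T : Subset n} {l : Fin n → Fin k} (p : Partition U S T) (hom : Homogeneous S T l) where

    private
      tag : Fin n → Fin (k + k)
      tag v with v ∈? S
      ... | yes _ = left (l v)
      ... | no  _ = right (l v)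

      tag-left : ∀ {v} → v ∈ S → tag v ≡ left (l v)
      tag-left {v} v∈S with v ∈? S
      ... | yes _   = refl
      ... | no  v∉S = contradiction v∈S v∉S

      tag-right : ∀ {v} → v ∈ T → tag v ≡ right (l v)
      tag-right {v} v∈T with v ∈? S
      ... | yes v∈S = contradiction v∈T (disjoint p v∈S)
      ... | no  _   = refl

      left-tag : ∀ {v i} → v ∈ U → tag v ≡ left i → v ∈ S × l v ≡ i
      left-tag {v} v∈U eq with v ∈? S
      ... | yes v∈S = v∈S , ↑ˡ-injective k _ _ eq
      ... | no  _   = contradiction eq (right≢left _ _)

      right-tag : ∀ {v i} → v ∈ U → tag v ≡ right i → v ∈ T × l v ≡ i
      right-tag {v} v∈U eq with v ∈? S | cover p v∈U
      ... | yes _   | _        = contradiction eq (left≢right _ _)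
      ... | no  v∉S | inj₁ v∈S = contradiction v∈S v∉S
      ... | no  _   | inj₂ v∈T = v∈T , ↑ʳ-injective k _ _ eq

      Linked : Fin k × Fin k → Set
      Linked (i , j) = ∃₂ λ s t → s ∈ S × t ∈ T × l s ≡ i × l t ≡ j × Adj s t

      linked? : Decidable Linked
      linked? (i , j) = any? λ s → any? λ t →
        s ∈? S ×-dec t ∈? T ×-dec l s ≟ i ×-dec l t ≟ j ×-dec adj? s t

      all pairs : List (Fin k × Fin k)
      all   = cartesianProduct (allFin k) (allFin k)
      pairs = filter linked? all

      back : ∀ {v} → v ∈ U → (∃ λ i → tag v ≡ right i × left (l v) ≡ left i) ⊎
                             ((∀ i → tag v ≢ right i) × left (l v) ≡ tag v)
      back v∈U with cover p v∈U
      ... | inj₁ v∈S = inj₂ ((λ i eq → left≢right _ _ (trans (sym (tag-left v∈S)) eq)) , sym (tag-left v∈S))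
      ... | inj₂ v∈T = inj₁ (_ , tag-right v∈T , refl)

      linked : ∀ {s t} → s ∈ S → t ∈ T → Adj s t → (l s , l t) List.∈ pairs
      linked {s} {t} s∈S t∈T a = ∈-filter⁺ linked? (∈-cartesianProduct⁺ (∈-allFin _) (∈-allFin _))
                                   (_ , _ , s∈S , t∈T , refl , refl , a)

      crossing : ∀ {s t i j} → s ∈ U → t ∈ U → (i , j) List.∈ pairs → tag s ≡ left i → tag t ≡ right j → Adj s t
      crossing s∈U t∈U ∈ps p q =
        let s∈S , ls = left-tag s∈U p
            t∈T , lt = right-tag t∈U q
            _ , _ , s′∈S , t′∈T , ls′ , lt′ , a = proj₂ (∈-filter⁻ linked? {xs = all} ∈ps)
        -- A pair of labels is joined because some edge witnesses it; homogeneity carries that edge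
        -- over to `s` and `t`.
        in hom s′∈S s∈S t′∈T t∈T (trans ls′ (sym ls)) (trans lt′ (sym lt)) a

      to : ∀ {a b} → a ∈ U → b ∈ U → Joined pairs tag (Within S T Adj) a b → Adj a b
      to a∈ b∈ (inj₁ (h , _)) = h
      to a∈ b∈ (inj₂ (_ , _ , ∈ps , inj₁ (p , q))) = crossing a∈ b∈ ∈ps p q
      to a∈ b∈ (inj₂ (_ , _ , ∈ps , inj₂ (p , q))) = symm (crossing b∈ a∈ ∈ps q p)

      from : ∀ {a b} → a ∈ U → b ∈ U → Adj a b → Joined pairs tag (Within S T Adj) a b
      from a∈ b∈ h with cover p a∈ | cover p b∈
      ... | inj₁ a∈S | inj₁ b∈S = inj₁ (h , inj₁ (a∈S , b∈S))
      ... | inj₂ a∈T | inj₂ b∈T = inj₁ (h , inj₂ (a∈T , b∈T))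
      ... | inj₁ a∈S | inj₂ b∈T = inj₂ (_ , _ , linked a∈S b∈T h , inj₁ (tag-left a∈S , tag-right b∈T))
      ... | inj₂ a∈T | inj₁ b∈S = inj₂ (_ , _ , linked b∈S a∈T (symm h) , inj₂ (tag-right a∈T , tag-left b∈S))

    -- Shift the labels of `T` to the right copy, take the disjoint union, join every pair of labels
    -- linked by an edge, and shift back. Homogeneity ensures that the joins add edges of `G` only.
    layout-merge : ∀ {e e′} → Layout e S Adj (left ∘ l) → Layout e′ T Adj (left ∘ l) →
                   ∃ λ e″ → Layout {m = k + k} e″ U Adj (left ∘ l)
    layout-merge r r′
      with _ , r₁ ← layout-shift left right (↑ˡ-injective k _ _) (λ i j → right≢left j i) (right ∘ l)
                      (λ _ → inj₁ (_ , refl , refl)) r′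
      with _ , r₂ ← layout-joins pairs
                      (layout-⊕ p (layout-resp (λ v∈S → sym (tag-left v∈S)) (λ _ _ → id) (λ _ _ → id) r)
                                  (layout-resp (λ v∈T → sym (tag-right v∈T)) (λ _ _ → id) (λ _ _ → id) r₁))
      with e₃ , r₃ ← layout-shift right left (↑ʳ-injective k _ _) (λ i j → left≢right j i) (left ∘ l) back r₂
      = e₃ , layout-resp (λ _ → refl) to from r₃

  module _ {S : Subset n} {l l′ : Fin n → Fin k}
           (coarser : ∀ {x y} → x ∈ S → y ∈ S → l x ≡ l y → l′ x ≡ l′ y) where

    private
      ρ : Fin k → Fin k
      ρ i with any? (λ x → x ∈? S ×-dec l x ≟ i)
      ... | yes (x , _) = l′ x
      -- A label absent from `S` may go anywhere; it stays.
      ... | no  _       = i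

      ρ-label : ∀ {v} → v ∈ S → ρ (l v) ≡ l′ v
      ρ-label {v} v∈S with any? (λ x → x ∈? S ×-dec l x ≟ l v)
      ... | yes (x , x∈S , eq) = coarser x∈S v∈S eq
      ... | no  none           = contradiction (v , v∈S , refl) none

    -- A direct renaming along `ρ` could move a label that an earlier rename has just produced. The
    -- targets are therefore taken in the right copy and then shifted back.
    layout-coarsen : ∀ {e} → Layout e S Adj (left ∘ l) → ∃ λ e′ → Layout {m = k + k} e′ S Adj (left ∘ l′)
    layout-coarsen r
      with _ , r₁ ← layout-shift left (right ∘ ρ) (↑ˡ-injective k _ _) (λ i j → right≢left _ i) (right ∘ l′)
                      (λ v∈S → inj₁ (_ , refl , cong right (sym (ρ-label v∈S)))) r
      = layout-shift right left (↑ʳ-injective k _ _) (λ i j → left≢right j i) (left ∘ l′)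
          (λ _ → inj₁ (_ , refl , refl)) r₁

  layout : ∀ {S l} → Built S l → ∃ λ e → Layout {m = k + k} e S Adj (left ∘ l)
  layout (point v v∈S only) = _ , layout-vertex v v∈S only (irrefl refl)
  layout (merge p hom b b′) = layout-merge p hom (proj₂ (layout b)) (proj₂ (layout b′))
  layout (coarsen c b)      = layout-coarsen c (proj₂ (layout b))

  built⇒≅ : ∀ {S l} → (∀ v → v ∈ S) → Built S l → ∃ λ (e : Expression (k + k)) → G ≅ ⟦ e ⟧
  built⇒≅ full b with e , r ← layout b = e , record
    { vertices  = mk↔ₛ′ (proj₁ ∘ pre) place (λ w → injective (proj₂ (pre (place w)))) (proj₂ ∘ pre)
    ; adjacency = λ u v → mk⇔
        (λ a → adj⁻ (subst (λ x → Adj x _) (sym (proj₂ (pre u))) (subst (Adj u) (sym (proj₂ (pre v))) a)))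
        (λ a → subst (λ x → Adj x v) (proj₂ (pre u)) (subst (Adj _) (proj₂ (pre v)) (adj⁺ a)))
    }
    where
    open Layout r
    pre : ∀ v → ∃ λ w → place w ≡ v
    pre v = onto (full v)

-- Twins and graphs of maximum degree two

module _ {n : ℕ} where

  within : ∀ U {P : Pred (Fin n) 0ℓ} → Decidable P → Decidable (λ v → v ∈ U × P v)
  within U P? v = v ∈? U ×-dec P? v

  restrict : Subset n → {P : Pred (Fin n) 0ℓ} → Decidable P → Subset n
  restrict U P? = select (within U P?)

  module _ (U : Subset n) {P : Pred (Fin n) 0ℓ} (P? : Decidable P) where

    ∈-restrict⁺ : ∀ {x} → x ∈ U → P x → x ∈ restrict U P?
    ∈-restrict⁺ x∈U px = ∈-select⁺ (within U P?) (x∈U , px)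

    ∈-restrict⁻ : ∀ {x} → x ∈ restrict U P? → x ∈ U × P x
    ∈-restrict⁻ = ∈-select⁻ (within U P?)

    restrict-⊂ : ∀ {y} → y ∈ U → ¬ P y → restrict U P? ⊂ U
    restrict-⊂ y∈U ¬py = proj₁ ∘ ∈-restrict⁻ , _ , y∈U , ¬py ∘ proj₂ ∘ ∈-restrict⁻

  restrict-partition : ∀ U {P : Pred (Fin n) 0ℓ} (P? : Decidable P) →
                       Partition U (restrict U P?) (restrict U (¬? ∘ P?))
  restrict-partition U P? = record
    { left⊆    = proj₁ ∘ ∈-restrict⁻ U P?
    ; right⊆   = proj₁ ∘ ∈-restrict⁻ U (¬? ∘ P?)
    ; cover    = λ {x} x∈U → case P? x of λ
        { (yes px) → inj₁ (∈-restrict⁺ U P? x∈U px)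
        ; (no ¬px) → inj₂ (∈-restrict⁺ U (¬? ∘ P?) x∈U ¬px) }
    ; disjoint = λ l r → proj₂ (∈-restrict⁻ U (¬? ∘ P?) r) (proj₂ (∈-restrict⁻ U P? l))
    }

  _∪ₛ_ : Subset n → Fin n → Subset n
  S ∪ₛ v = S ∪ˢ ⁅ v ⁆

  old : ∀ {S v x} → x ∈ S → x ∈ S ∪ₛ v
  old = p⊆p∪q _

  new : ∀ {S v} → v ∈ S ∪ₛ v
  new {S} {v} = q⊆p∪q S ⁅ v ⁆ (x∈⁅x⁆ v)

  ∪ₛ⁻ : ∀ {S v x} → x ∈ S ∪ₛ v → x ∈ S ⊎ x ≡ v
  ∪ₛ⁻ {S} {v} x∈ = Sum.map id (x∈⁅y⁆⇒x≡y v) (x∈p∪q⁻ S ⁅ v ⁆ x∈)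

  attach : ∀ {S v} → v ∉ S → Partition (S ∪ₛ v) S ⁅ v ⁆
  attach {S} {v} v∉S = record
    { left⊆    = old
    ; right⊆   = q⊆p∪q S ⁅ v ⁆
    ; cover    = x∈p∪q⁻ S ⁅ v ⁆
    ; disjoint = λ x∈S x∈v → v∉S (subst (_∈ S) (x∈⁅y⁆⇒x≡y v x∈v) x∈S)
    }

  ∪ₛ-⊃ : ∀ {S v} → v ∉ S → (S ∪ₛ v) ⊃ S
  ∪ₛ-⊃ {S} v∉S = old , _ , new {S} , v∉S

module Building (G : Graph) {k : ℕ} where

  open Graph G renaming (order to n)

  built-single : ∀ v {l : Fin n → Fin k} → Built G ⁅ v ⁆ l
  built-single v = point v (x∈⁅x⁆ v) (x∈⁅y⁆⇒x≡y v)

  built-cong : ∀ {S} {l l′ : Fin n → Fin k} → (∀ {x} → x ∈ S → l′ x ≡ l x) → Built G S l → Built G S l′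
  built-cong same = coarsen λ x∈ y∈ eq → trans (same x∈) (trans eq (sym (same y∈)))

  homogeneous-sym : ∀ {S T} {l : Fin n → Fin k} → Homogeneous G S T l → Homogeneous G T S l
  homogeneous-sym hom s∈ s′∈ t∈ t′∈ ls lt a = symm (hom t∈ t′∈ s∈ s′∈ lt ls (symm a))

  built-attach : ∀ {S v} {l : Fin n → Fin k} → v ∉ S →
                 (∀ {s s′} → s ∈ S → s′ ∈ S → l s ≡ l s′ → Adj s v → Adj s′ v) →
                 Built G S l → Built G (S ∪ₛ v) l
  built-attach {S} {v} {l} v∉S hom b = merge (attach v∉S) hom′ b (built-single v)
    where
    hom′ : Homogeneous G S ⁅ v ⁆ l
    hom′ s∈ s′∈ t∈ t′∈ ls _ a with refl ← x∈⁅y⁆⇒x≡y v t∈ | refl ← x∈⁅y⁆⇒x≡y v t′∈ = hom s∈ s′∈ ls a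

  module _ {v v′ : Fin n} where

    private
      partition-twin : ∀ {U S T} → Partition U S T → v′ ∉ U → Partition (U ∪ₛ v′) (S ∪ₛ v′) T
      partition-twin {U} {S} {T} p v′∉U = record
        { left⊆    = λ x∈ → case ∪ₛ⁻ {S = S} x∈ of λ { (inj₁ x∈S) → old (left⊆ p x∈S) ; (inj₂ refl) → new {S = U} }
        ; right⊆   = old ∘ right⊆ p
        ; cover    = λ x∈ → case ∪ₛ⁻ {S = U} x∈ of λ
            { (inj₁ x∈U) → Sum.map old id (cover p x∈U) ; (inj₂ refl) → inj₁ (new {S = S}) }
        ; disjoint = λ x∈ x∈T → case ∪ₛ⁻ {S = S} x∈ of λ
            { (inj₁ x∈S) → disjoint p x∈S x∈T ; (inj₂ refl) → v′∉U (right⊆ p x∈T) }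
        }

      homogeneous-twin : ∀ {S T} {l l′ : Fin n → Fin k} → v ∈ S → (∀ {x} → x ∈ S ⊎ x ∈ T → l′ x ≡ l x) →
        l′ v′ ≡ l v → (∀ {w} → w ∈ T → Adj v w → Adj v′ w) → (∀ {w} → w ∈ T → Adj v′ w → Adj v w) →
        Homogeneous G S T l → Homogeneous G (S ∪ₛ v′) T l′
      homogeneous-twin {S} {T} {l} {l′} v∈S same lv to from hom s∈ s′∈ t∈ t′∈ ls lt a
        with ∪ₛ⁻ {S = S} s∈ | ∪ₛ⁻ {S = S} s′∈ | trans (sym (same (inj₂ t∈))) (trans lt (same (inj₂ t′∈)))
      ... | inj₁ s∈S  | inj₁ s′∈S | lt′ =
        hom s∈S s′∈S t∈ t′∈ (trans (sym (same (inj₁ s∈S))) (trans ls (same (inj₁ s′∈S)))) lt′ a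
      ... | inj₁ s∈S  | inj₂ refl | lt′ =
        to t′∈ (hom s∈S v∈S t∈ t′∈ (trans (sym (same (inj₁ s∈S))) (trans ls lv)) lt′ a)
      ... | inj₂ refl | inj₁ s′∈S | lt′ =
        hom v∈S s′∈S t∈ t′∈ (trans (sym lv) (trans ls (same (inj₁ s′∈S)))) lt′ (from t∈ a)
      ... | inj₂ refl | inj₂ refl | lt′ = to t′∈ (hom v∈S v∈S t∈ t′∈ refl lt′ (from t∈ a))

    -- The twin `v′` accompanies `v` through the whole construction and is attached where `v` stands
    -- alone. Allowing `l′` to differ from `l` off `S` is what lets `v′` receive the label of `v`
    -- below a `coarsen`.
    built-twin : ∀ {S} {l l′ : Fin n → Fin k} → Built G S l → v ∈ S → v′ ∉ S →
      (∀ {w} → w ∈ S → Adj v w → Adj v′ w) → (∀ {w} → w ∈ S → Adj v′ w → Adj v w) →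
      (∀ {x} → x ∈ S → l′ x ≡ l x) → l′ v′ ≡ l v → Built G (S ∪ₛ v′) l′
    built-twin {l′ = l′} b@(point u u∈S only) v∈S v′∉S to from same lv =
      built-attach v′∉S (λ s∈ s′∈ _ → subst (λ x → Adj x v′) (trans (only s∈) (sym (only s′∈))))
        (built-cong same b)
    built-twin (merge p hom b b′) v∈U v′∉U to from same lv with cover p v∈U
    ... | inj₁ v∈S = merge (partition-twin p v′∉U)
          (homogeneous-twin v∈S (same ∘ [ left⊆ p , right⊆ p ]′) lv (to ∘ right⊆ p) (from ∘ right⊆ p) hom)
          (built-twin b v∈S (v′∉U ∘ left⊆ p) (to ∘ left⊆ p) (from ∘ left⊆ p) (same ∘ left⊆ p) lv)
          (built-cong (same ∘ right⊆ p) b′)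
    ... | inj₂ v∈T = merge (partition-twin (partition-sym p) v′∉U)
          (homogeneous-twin v∈T (same ∘ [ right⊆ p , left⊆ p ]′) lv (to ∘ left⊆ p) (from ∘ left⊆ p)
            (homogeneous-sym hom))
          (built-twin b′ v∈T (v′∉U ∘ right⊆ p) (to ∘ right⊆ p) (from ∘ right⊆ p) (same ∘ right⊆ p) lv)
          (built-cong (same ∘ left⊆ p) b)
    built-twin {S} {l′ = l′} (coarsen {l = l₀} {l} coarser b) v∈S v′∉S to from same lv =
      coarsen coarser′ (built-twin {l′ = l₀′} b v∈S v′∉S to from off on)
      where
      l₀′ : Fin n → Fin k
      l₀′ x with x ≟ v′
      ... | yes _ = l₀ v
      ... | no  _ = l₀ x

      on : l₀′ v′ ≡ l₀ v
      on with v′ ≟ v′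
      ... | yes _ = refl
      ... | no ne = contradiction refl ne

      off : ∀ {x} → x ∈ S → l₀′ x ≡ l₀ x
      off {x} x∈S with x ≟ v′
      ... | yes refl = contradiction x∈S v′∉S
      ... | no  _    = refl

      source : ∀ {x} → x ∈ S ∪ₛ v′ → ∃ λ y → y ∈ S × l₀′ x ≡ l₀ y × l′ x ≡ l y
      source x∈ with ∪ₛ⁻ {S = S} x∈
      ... | inj₁ x∈S  = _ , x∈S , off x∈S , same x∈S
      ... | inj₂ refl = v , v∈S , on , lv

      coarser′ : ∀ {x y} → x ∈ S ∪ₛ v′ → y ∈ S ∪ₛ v′ → l₀′ x ≡ l₀′ y → l′ x ≡ l′ y
      coarser′ x∈ y∈ eq with source x∈ | source y∈
      ... | a , a∈S , xa , xa′ | b , b∈S , yb , yb′ =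
        trans xa′ (trans (coarser a∈S b∈S (trans (sym xa) (trans eq yb))) (sym yb′))

bit : Bool → Fin 2
bit false = 0F
bit true  = 1F

bit-injective : ∀ {a b} → bit a ≡ bit b → a ≡ b
bit-injective {false} {false} _ = refl
bit-injective {true}  {true}  _ = refl

-- Sixteen labels are used throughout so that all constructions fit together. Here they are two
-- colours times the eight values of three marks, with all marks cleared.
colour : ∀ {n} → (Fin n → Bool) → Fin n → Fin 16
colour col x = combine (bit (col x)) (zero {7})

-- Following paths and cycles

module Thin (G : Graph) (U : Subset (Graph.order G)) (col : Graph.Vertex G → Bool) where

  open Graph G renaming (order to n)
  open Building G

  mark : Fin n → Fin n → Fin 2
  mark a x = bit (does (x ≟ a))

  marked : ∀ {a x y} → mark a x ≡ mark a y → x ≡ a → y ≡ a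
  marked {a} {x} {y} eq x≡a with x ≟ a | y ≟ a
  ... | _       | yes y≡a = y≡a
  ... | no  x≢a | no  _   = contradiction x≡a x≢a
  marked () x≡a | yes _ | no _

  unmarked : ∀ {a x} → x ≢ a → mark a x ≡ 0F
  unmarked {a} {x} x≢a rewrite dec-false (x ≟ a) x≢a = refl

  -- Two marks single out the ends of the current path; the third is free for the vertex being
  -- attached, which then takes over the mark of an end.
  tag : Fin n → Fin n → Fin n → Fin n → Fin 16
  tag a b c x = combine (bit (col x)) (combine (mark a x) (combine (mark b x) (mark c x)))

  record Agree (a b c x y : Fin n) : Set where
    field
      colours : bit (col x) ≡ bit (col y)
      mark₁   : mark a x ≡ mark a y
      mark₂   : mark b x ≡ mark b y
      mark₃   : mark c x ≡ mark c y

  open Agree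

  agree : ∀ {a b c x y} → tag a b c x ≡ tag a b c y → Agree a b c x y
  agree {a} {b} {c} {x} {y} eq
    with p , eq₁ ← combine-injective (bit (col x)) _ (bit (col y)) _ eq
    with q , eq₂ ← combine-injective (mark a x) _ (mark a y) _ eq₁
    with r , s ← combine-injective (mark b x) _ (mark b y) _ eq₂
    = record { colours = p ; mark₁ = q ; mark₂ = r ; mark₃ = s }

  agreed : ∀ {a b c x y} → Agree a b c x y → tag a b c x ≡ tag a b c y
  agreed h = cong₂ combine (colours h) (cong₂ combine (mark₁ h) (cong₂ combine (mark₂ h) (mark₃ h)))

  retag : ∀ {S a b c a′ b′ c′} → (∀ {x y} → x ∈ S → y ∈ S → Agree a b c x y → Agree a′ b′ c′ x y) →
          Built G S (tag a b c) → Built G S (tag a′ b′ c′)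
  retag f = coarsen λ x∈ y∈ eq → agreed (f x∈ y∈ (agree eq))

  -- S grows along one path or cycle at a time, so at most two edges leave it, here p p′ and q q′.

  Exits : Subset n → Fin n → Fin n → Fin n → Fin n → Set
  Exits S p p′ q q′ = ∀ {s t} → s ∈ S → t ∈ U → t ∉ S → Adj s t → (s ≡ p × t ≡ p′) ⊎ (s ≡ q × t ≡ q′)

  State : Subset n → Set
  State S = ∃₂ λ p q → ∃₂ λ p′ q′ → Built G S (tag p p q) × Exits S p p′ q q′

  module _ (thin : ∀ {v a b c} → v ∈ U → a ∈ U → b ∈ U → c ∈ U → Adj v a → Adj v b → Adj v c →
                   a ≡ b ⊎ a ≡ c ⊎ b ≡ c) where

    -- When there is no such neighbour the witness defaults to `v`, so the exits of a state are
    -- always defined; the corresponding exit condition is then vacuous.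
    other : ∀ (S : Subset n) v w → ∃ λ t′ → (∃ λ t → t ∈ U × t ∉ S × t ≢ w × Adj v t) →
            t′ ∈ U × t′ ∉ S × t′ ≢ w × Adj v t′
    other S v w with any? (λ t → t ∈? U ×-dec ¬? (t ∈? S) ×-dec ¬? (t ≟ w) ×-dec adj? v t)
    ... | yes (t , h) = t , λ _ → h
    ... | no  none    = v , λ h → contradiction h none

    -- The new vertex `w` replaces `p` as an end. It has `p` behind it, so by thinness at most one
    -- edge leads from it out of the enlarged set.
    cross : ∀ {S p q p′ q′} → S ⊆ U → p ∈ S → p′ ∈ U → p′ ∉ S → Adj p p′ →
            Built G S (tag p p q) → Exits S p p′ q q′ → State (S ∪ₛ p′)
    cross {S} {p} {q} {w} {q′} S⊆U p∈S w∈U w∉S p~w b exits = w , q , proj₁ next , q′ , built , exits′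
      where
      next = other (S ∪ₛ w) w p

      neq : ∀ {x} → x ∈ S → x ≢ w
      neq x∈S refl = w∉S x∈S

      built : Built G (S ∪ₛ w) (tag w w q)
      built = retag {a = w} {b = p} {c = q}
        (λ _ _ h → record { colours = colours h ; mark₁ = mark₁ h ; mark₂ = mark₁ h ; mark₃ = mark₃ h })
        (built-attach w∉S hom (retag {a = p} {b = p} {c = q}
          (λ x∈ y∈ h → record { colours = colours h
                              ; mark₁ = trans (unmarked (neq x∈)) (sym (unmarked (neq y∈)))
                              ; mark₂ = mark₂ h ; mark₃ = mark₃ h }) b))
        where
        hom : ∀ {s s′} → s ∈ S → s′ ∈ S → tag w p q s ≡ tag w p q s′ → Adj s w → Adj s′ w
        -- Only the ends `p` and `q` can be neighbours of `w` in `S`, and both are marked, so the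
        -- label decides adjacency to `w`.
        hom s∈ s′∈ eq a with exits s∈ w∈U w∉S a
        ... | inj₁ (s≡p , _) = subst (λ x → Adj x w) (sym (marked (mark₂ (agree eq)) s≡p)) p~w
        ... | inj₂ (s≡q , _) = subst (λ x → Adj x w) (trans s≡q (sym (marked (mark₃ (agree eq)) s≡q))) a

      exits′ : Exits (S ∪ₛ w) w (proj₁ next) q q′
      exits′ {s} {t} s∈ t∈U t∉ a with ∪ₛ⁻ {S = S} s∈
      ... | inj₁ s∈S with exits s∈S t∈U (t∉ ∘ old) a
      ...   | inj₁ (_ , refl) = contradiction (new {S = S}) t∉
      ...   | inj₂ h          = inj₂ h
      exits′ {s} {t} s∈ t∈U t∉ a | inj₂ refl
        with t≢p ← (λ eq → t∉ (old (subst (_∈ S) (sym eq) p∈S)))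
        with t′∈U , _ , t′≢p , w~t′ ← proj₂ next (t , t∈U , t∉ , t≢p , a)
        with thin w∈U (S⊆U p∈S) t∈U t′∈U (symm p~w) a w~t′
      ... | inj₁ p≡t         = contradiction (sym p≡t) t≢p
      ... | inj₂ (inj₁ p≡t′) = contradiction (sym p≡t′) t′≢p
      ... | inj₂ (inj₂ t≡t′) = inj₁ (refl , t≡t′)

    fresh-exits : ∀ {v} → v ∈ U → ∃₂ λ p′ q′ → ∀ {t} → t ∈ U → Adj v t → t ≡ p′ ⊎ t ≡ q′
    fresh-exits {v} v∈U = proj₁ one , proj₁ two , exit
      where
      one = other ⁅ v ⁆ v v
      two = other ⁅ v ⁆ v (proj₁ one)

      ∉-single : ∀ {t} → Adj v t → t ∉ ⁅ v ⁆
      ∉-single a t∈ = irrefl (sym (x∈⁅y⁆⇒x≡y v t∈)) a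

      exit : ∀ {t} → t ∈ U → Adj v t → t ≡ proj₁ one ⊎ t ≡ proj₁ two
      exit {t} t∈U a with t ≟ proj₁ one
      ... | yes t≡ = inj₁ t≡
      ... | no  t≢
        with a∈U , _ , _ , v~a ← proj₂ one (t , t∈U , ∉-single a , (λ eq → irrefl (sym eq) a) , a)
        with b∈U , _ , b≢a , v~b ← proj₂ two (t , t∈U , ∉-single a , t≢ , a)
        with thin v∈U t∈U a∈U b∈U a v~a v~b
      ... | inj₁ t≡a        = contradiction t≡a t≢
      ... | inj₂ (inj₁ t≡b) = inj₂ t≡b
      ... | inj₂ (inj₂ a≡b) = contradiction (sym a≡b) b≢a

    -- No edge leaves `S`, so its marks can be cleared and a new path started at `v`, which is at
    -- first both of its ends.
    fresh : ∀ {S p q v} → v ∈ U → v ∉ S → (∀ {s t} → s ∈ S → t ∈ U → t ∉ S → ¬ Adj s t) →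
            Built G S (tag p p q) → State (S ∪ₛ v)
    fresh {S} {p} {q} {v} v∈U v∉S closed b with p′ , q′ , exit ← fresh-exits v∈U =
      v , v , p′ , q′ ,
      built-attach v∉S (λ s∈ _ _ a → contradiction a (closed s∈ v∈U v∉S))
        (retag {a = p} {b = p} {c = q} (λ x∈ y∈ h → let m = trans (unmarked (neq x∈)) (sym (unmarked (neq y∈))) in
          record { colours = colours h ; mark₁ = m ; mark₂ = m ; mark₃ = m }) b) ,
      exits
      where
      neq : ∀ {x} → x ∈ S → x ≢ v
      neq x∈S refl = v∉S x∈S

      exits : Exits (S ∪ₛ v) v p′ v q′
      exits s∈ t∈U t∉ a with ∪ₛ⁻ {S = S} s∈
      ... | inj₁ s∈S  = contradiction a (closed s∈S t∈U (t∉ ∘ old))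
      ... | inj₂ refl = Sum.map (refl ,_) (refl ,_) (exit t∈U a)

    grow : ∀ S → Acc _⊃_ S → S ⊆ U → State S → Built G U (colour col)
    grow S (acc rec) S⊆U (p , q , p′ , q′ , b , exits)
      with any? (λ s → any? λ t → s ∈? S ×-dec t ∈? U ×-dec ¬? (t ∈? S) ×-dec adj? s t)
    ... | yes (s , t , s∈S , t∈U , t∉S , a) =
      grow (S ∪ₛ t) (rec (∪ₛ-⊃ t∉S)) (λ x∈ → [ S⊆U , (λ { refl → t∈U }) ]′ (∪ₛ⁻ {S = S} x∈)) (state (exits s∈S t∈U t∉S a))
      where
      state : (s ≡ p × t ≡ p′) ⊎ (s ≡ q × t ≡ q′) → State (S ∪ₛ t)
      state (inj₁ (refl , refl)) = cross S⊆U s∈S t∈U t∉S a b exits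
      -- The path is extended at its other end: exchange the marks of `p` and `q` and argue as
      -- before.
      state (inj₂ (refl , refl)) = cross {q = p} S⊆U s∈S t∈U t∉S a
        (retag {a = p} {b = p} {c = q} (λ _ _ h → record
          { colours = colours h ; mark₁ = mark₃ h ; mark₂ = mark₃ h ; mark₃ = mark₁ h }) b)
        (λ s∈ t∈ t∉ a → Sum.swap (exits s∈ t∈ t∉ a))
    ... | no none with any? (λ v → v ∈? U ×-dec ¬? (v ∈? S))
    ...   | yes (v , v∈U , v∉S) =
      grow (S ∪ₛ v) (rec (∪ₛ-⊃ v∉S)) (λ x∈ → [ S⊆U , (λ { refl → v∈U }) ]′ (∪ₛ⁻ {S = S} x∈))
        (fresh {p = p} {q = q} v∈U v∉S (λ s∈ t∈ t∉ a → none (_ , _ , s∈ , t∈ , t∉ , a)) b)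
    ...   | no all∈ = subst (λ X → Built G X (colour col)) (⊆-antisym S⊆U U⊆S)
      (coarsen (λ _ _ eq → cong (λ i → combine i (zero {7})) (colours (agree {p} {p} {q} eq))) b)
      where
      U⊆S : U ⊆ S
      U⊆S {x} x∈U with x ∈? S
      ... | yes x∈S = x∈S
      ... | no  x∉S = contradiction (x , x∈U , x∉S) all∈

    built-thin : Nonempty U → Built G U (colour col)
    built-thin (v , v∈U) with p′ , q′ , exit ← fresh-exits v∈U =
      grow ⁅ v ⁆ (⊃-wellFounded _) (λ x∈ → subst (_∈ U) (sym (x∈⁅y⁆⇒x≡y v x∈)) v∈U)
        (v , v , p′ , q′ , built-single v ,
         λ s∈ t∈U _ a → let s≡v = x∈⁅y⁆⇒x≡y v s∈ in
           Sum.map (s≡v ,_) (s≡v ,_) (exit t∈U (subst (λ x → Adj x _) s≡v a)))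

-- Forbidden induced subgraphs

module _ (H : Graph) (es ne : List (Graph.Vertex H × Graph.Vertex H)) where

  private module H = Graph H

  -- Certifies by computation that `es` and `ne` exhaust the pairs of distinct vertices, so that a
  -- copy of `H` is given by one proof per listed pair.
  Classified : Graph.Vertex H → Graph.Vertex H → Set
  Classified i j = (H.Adj i j × Listed es i j) ⊎ (¬ H.Adj i j × (i ≡ j ⊎ Listed ne i j))

  classified? : ∀ i j → Dec (Classified i j)
  classified? i j = (H.adj? i j ×-dec listed? es i j) ⊎-dec (¬? (H.adj? i j) ×-dec ((i ≟ j) ⊎-dec listed? ne i j))

  Twins : Graph.Vertex H → Graph.Vertex H → Set
  Twins i j = ∀ k → (H.Adj i k → H.Adj j k) × (H.Adj j k → H.Adj i k)

  twins? : ∀ i j → Dec (Twins i j)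
  twins? i j = all? λ k → (H.adj? i k →-dec H.adj? j k) ×-dec (H.adj? j k →-dec H.adj? i k)

  -- In a graph H without twins a map that preserves and reflects adjacency is injective.

  induced-copy : (∀ i j → Classified i j) → (∀ i j → Twins i j → i ≡ j) →
                 ∀ G (f : H.Vertex → Graph.Vertex G) →
                 All (λ e → Graph.Adj G (f (proj₁ e)) (f (proj₂ e))) es →
                 All (λ e → ¬ Graph.Adj G (f (proj₁ e)) (f (proj₂ e))) ne → H ⊴ G
  induced-copy classified twin-free G f edges nonedges = record
    { embed     = f
    ; injective = λ {i} {j} eq → twin-free i j λ k →
        (λ a → from j k (subst (λ v → G.Adj v (f k)) eq (to i k a))) ,
        (λ a → from i k (subst (λ v → G.Adj v (f k)) (sym eq) (to j k a)))
    ; adjacency = λ i j → mk⇔ (to i j) (from i j)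
    }
    where
    module G = Graph G

    to : ∀ i j → H.Adj i j → G.Adj (f i) (f j)
    to i j a with classified i j
    ... | inj₁ (_ , inj₁ ij∈) = All.lookup edges ij∈
    ... | inj₁ (_ , inj₂ ji∈) = G.symm (All.lookup edges ji∈)
    ... | inj₂ (¬a , _)       = contradiction a ¬a

    from : ∀ i j → G.Adj (f i) (f j) → H.Adj i j
    from i j a with classified i j
    ... | inj₁ (b , _)               = b
    ... | inj₂ (_ , inj₁ refl)       = contradiction a (G.irrefl refl)
    ... | inj₂ (_ , inj₂ (inj₁ ij∈)) = contradiction a (All.lookup nonedges ij∈)
    ... | inj₂ (_ , inj₂ (inj₂ ji∈)) = contradiction (G.symm a) (All.lookup nonedges ji∈)

triangle-edges : List (Fin 3 × Fin 3)
triangle-edges = (0F , 1F) ∷ (0F , 2F) ∷ (1F , 2F) ∷ []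

spider-edges spider-nonedges : List (Fin 6 × Fin 6)
spider-edges    = (0F , 1F) ∷ (0F , 2F) ∷ (2F , 3F) ∷ (0F , 4F) ∷ (4F , 5F) ∷ []
spider-nonedges = (0F , 3F) ∷ (0F , 5F) ∷ (1F , 2F) ∷ (1F , 3F) ∷ (1F , 4F) ∷ (1F , 5F) ∷
                  (2F , 4F) ∷ (2F , 5F) ∷ (3F , 4F) ∷ (3F , 5F) ∷ []

triangle-copy : ∀ G (f : Fin 3 → Graph.Vertex G) →
                All (λ e → Graph.Adj G (f (proj₁ e)) (f (proj₂ e))) triangle-edges → K₃ ⊴ G
triangle-copy G f edges = induced-copy K₃ triangle-edges []
  (toWitness {a? = all? λ i → all? λ j → classified? K₃ triangle-edges [] i j} _)
  (toWitness {a? = all? λ i → all? λ j → twins? K₃ triangle-edges [] i j →-dec (i ≟ j)} _)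
  G f edges []

spider-copy : ∀ G (f : Fin 6 → Graph.Vertex G) →
              All (λ e → Graph.Adj G (f (proj₁ e)) (f (proj₂ e))) spider-edges →
              All (λ e → ¬ Graph.Adj G (f (proj₁ e)) (f (proj₂ e))) spider-nonedges → S₁₂₂ ⊴ G
spider-copy = induced-copy S₁₂₂ spider-edges spider-nonedges
  (toWitness {a? = all? λ i → all? λ j → classified? S₁₂₂ spider-edges spider-nonedges i j} _)
  (toWitness {a? = all? λ i → all? λ j → twins? S₁₂₂ spider-edges spider-nonedges i j →-dec (i ≟ j)} _)

module Forbidden (G : Graph) (free : ((｛ S₁₂₂ ｝ ∪ ｛ K₃ ｝) -Free) G) where

  open Graph G renaming (order to n) public

  infix 4 _~_ _≁_ _~?_

  _~_ _≁_ : Fin n → Fin n → Set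
  _~_   = Adj
  x ≁ y = ¬ Adj x y

  _~?_ : ∀ x y → Dec (x ~ y)
  _~?_ = adj?

  flip : ∀ {x y} → x ≁ y → y ≁ x
  flip x≁y y~x = x≁y (symm y~x)

  abstract

    stable : ∀ {x y} → ¬ (x ≁ y) → x ~ y
    stable = decidable-stable (adj? _ _)

    △ : ∀ {x y z} → x ~ y → x ~ z → y ≁ z
    △ {x} {y} {z} xy xz yz = free K₃ (inj₂ refl)
      (triangle-copy G (lookup (x ∷ y ∷ z ∷ [])) (xy ∷ xz ∷ yz ∷ []))

    -- The remaining nonadjacencies of S₁₂₂ hold because G has no triangle.

    spider : ∀ {u x y y′ z z′} → u ~ x → u ~ y → y ~ y′ → u ~ z → z ~ z′ →
             x ≁ y′ → x ≁ z′ → y ≁ z′ → z ≁ y′ → y′ ≁ z′ → ⊥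
    spider {u} {x} {y} {y′} {z} {z′} ux uy yy′ uz zz′ xy′ xz′ yz′ zy′ y′z′ = free S₁₂₂ (inj₁ refl)
      (spider-copy G (lookup (u ∷ x ∷ y ∷ y′ ∷ z ∷ z′ ∷ []))
        (ux ∷ uy ∷ yy′ ∷ uz ∷ zz′ ∷ [])
        (△ (symm uy) yy′ ∷ △ (symm uz) zz′ ∷ △ ux uy ∷ xy′ ∷ △ ux uz ∷ xz′ ∷
         △ uy uz ∷ yz′ ∷ flip zy′ ∷ y′z′ ∷ []))

-- Graphs without a pentagon

module Structure (G : Graph) (free : ((｛ S₁₂₂ ｝ ∪ ｛ K₃ ｝) -Free) G) where

  open Forbidden G free

  -- In a triangle-free graph a closed walk of length five runs round an induced five-cycle, so five
  -- edges determine a pentagon.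
  record Pentagon (a b c d e : Fin n) : Set where
    constructor pentagon
    field
      ab : a ~ b
      bc : b ~ c
      cd : c ~ d
      de : d ~ e
      ea : e ~ a

  PentagonFree : Subset n → Set
  PentagonFree U = ∀ {a b c d e} → a ∈ U → b ∈ U → c ∈ U → d ∈ U → e ∈ U → ¬ Pentagon a b c d e

  Separated : Subset n → Fin n → Fin n → Set
  Separated U v v′ = ∃ λ z → z ∈ U × ((z ~ v × z ≁ v′) ⊎ (z ~ v′ × z ≁ v))

  -- The common neighbour `w` forces `v` and `v′` to have the same colour in every proper
  -- two-colouring, so that a twin can take over a label that records the colour.
  TwinFree : Subset n → Set
  TwinFree U = ∀ {v v′ w} → v ∈ U → v′ ∈ U → w ∈ U → v ≢ v′ → w ~ v → w ~ v′ → Separated U v v′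

  Proper : Subset n → (Fin n → Bool) → Set
  Proper U col = ∀ {s t} → s ∈ U → t ∈ U → s ~ t → col s ≢ col t

  -- In `series` the classes are `W` and its complement, and no edge of the bipartite complement
  -- crosses `P`. The clause on `col` says that every proper two-colouring has these classes, so a
  -- colouring fixed beforehand can serve as labelling.
  data Decomposition (U : Subset n) (u : Fin n) : Set₁ where
    parallel : ∀ {P : Pred (Fin n) 0ℓ} (P? : Decidable P) {s t} → s ∈ U → P s → t ∈ U → ¬ P t →
               (∀ {s t} → s ∈ U → t ∈ U → P s → ¬ P t → s ≁ t) → Decomposition U u
    series   : ∀ {W P : Pred (Fin n) 0ℓ} (W? : Decidable W) (P? : Decidable P) →
               (∀ {s t} → s ∈ U → t ∈ U → s ~ t → (W s × ¬ W t) ⊎ (¬ W s × W t)) →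
               (∀ {col} → Proper U col → ∀ {s} → s ∈ U →
                 (W s → col s ≡ not (col u)) × (¬ W s → col s ≡ col u)) →
               ∀ {s t} → s ∈ U → P s → t ∈ U → ¬ P t →
               (∀ {s t} → s ∈ U → t ∈ U → P s → ¬ P t → (W s × ¬ W t) ⊎ (¬ W s × W t) → s ~ t) →
               Decomposition U u

  -- `outside` is the form in which maximality of the neighbourhood of `u` enters: no other vertex
  -- is adjacent to all of it.
  module Layers
    (U : Subset n) (pentagon-free : PentagonFree U) (twin-free : TwinFree U)
    (u : Fin n) (u∈U : u ∈ U)
    (outside : ∀ {y} → y ∈ U → y ≢ u → ∃ λ x → (x ∈ U × u ~ x) × y ≁ x)
    {a₁ a₂ a₃ : Fin n}
    (a₁∈U : a₁ ∈ U) (a₂∈U : a₂ ∈ U) (a₃∈U : a₃ ∈ U) (ua₁ : u ~ a₁) (ua₂ : u ~ a₂) (ua₃ : u ~ a₃)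
    (a₁≢a₂ : a₁ ≢ a₂) (a₁≢a₃ : a₁ ≢ a₃) (a₂≢a₃ : a₂ ≢ a₃)
    where

    -- Distance layers from u, where Z holds the vertices at distance at least three.

    L₁ L₂ Z L₃ L₄ Far : Pred (Fin n) 0ℓ
    L₁ a  = a ∈ U × u ~ a
    L₂ y  = y ∈ U × y ≢ u × ∃ λ a → L₁ a × y ~ a
    Z z   = z ∈ U × z ≢ u × u ≁ z × (∀ a → L₁ a → z ≁ a)
    L₃ b  = Z b × ∃ λ y → L₂ y × y ~ b
    L₄ e  = Z e × (∀ y → L₂ y → e ≁ y) × ∃ λ b → L₃ b × e ~ b
    Far v = Z v × (∀ y → L₂ y → v ≁ y) × (∀ b → L₃ b → v ≁ b)

    L₁? : Decidable L₁
    L₁? a = a ∈? U ×-dec u ~? a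

    L₂? : Decidable L₂
    L₂? y = y ∈? U ×-dec ¬? (y ≟ u) ×-dec any? λ a → L₁? a ×-dec y ~? a

    Z? : Decidable Z
    Z? z = z ∈? U ×-dec ¬? (z ≟ u) ×-dec ¬? (u ~? z) ×-dec all? λ a → L₁? a →-dec ¬? (z ~? a)

    L₃? : Decidable L₃
    L₃? b = Z? b ×-dec any? λ y → L₂? y ×-dec y ~? b

    Far? : Decidable Far
    Far? v = Z? v ×-dec all? (λ y → L₂? y →-dec ¬? (v ~? y)) ×-dec all? λ b → L₃? b →-dec ¬? (v ~? b)

    abstract

      outside₂ : ∀ {y} → L₂ y → ∃ λ x → L₁ x × y ≁ x
      outside₂ (y∈U , y≢u , _) = outside y∈U y≢u

      u≁₂ : ∀ {y} → L₂ y → u ≁ y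
      u≁₂ (_ , _ , a , (_ , ua) , ya) = △ (symm ua) (symm ya)

      u≁ᶻ : ∀ {z} → Z z → u ≁ z
      u≁ᶻ (_ , _ , u≁z , _) = u≁z

      ₁≁ᶻ : ∀ {a z} → L₁ a → Z z → a ≁ z
      ₁≁ᶻ {a} a∈ (_ , _ , _ , z≁) = flip (z≁ a a∈)

      -- An edge within `L₂` would close a walk of length five through `u`.
      independent₂ : ∀ {y z} → L₂ y → L₂ z → y ≁ z
      independent₂ (y∈ , _ , a , (a∈ , ua) , ya) (z∈ , _ , a′ , (a′∈ , ua′) , za′) yz =
        pentagon-free u∈U a∈ y∈ z∈ a′∈ (pentagon ua (symm ya) yz za′ (symm ua′))

      -- A spider centred at `u` with short leg `x` and long legs through `a` and `a′`. Hence
      -- incomparable traces on `L₁` together cover `L₁`.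
      cross-free : ∀ {y z a a′ x} → L₂ y → L₂ z → L₁ a → y ~ a → z ≁ a → L₁ a′ → z ~ a′ → y ≁ a′ →
                   L₁ x → y ≁ x → z ≁ x → ⊥
      cross-free y z (_ , ua) ya z≁a (_ , ua′) za′ y≁a′ (_ , ux) y≁x z≁x =
        spider ux ua (symm ya) ua′ (symm za′) (flip y≁x) (flip z≁x) (flip z≁a) (flip y≁a′) (independent₂ y z)

      -- A spider centred at `t`, with short leg `z` and long legs `u`, `x` and `y`, `r`. By
      -- symmetry, vertices with a common neighbour and a common non-neighbour in `L₁` have the same
      -- neighbours in `Z`.
      transfer : ∀ {y z t x r} → L₁ t → y ~ t → z ~ t → L₁ x → y ≁ x → z ≁ x → Z r → y ~ r → z ~ r
      transfer (_ , ut) yt zt x@(_ , ux) y≁x z≁x r yr = stable λ z≁r →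
        spider (symm zt) (symm ut) ux (symm yt) yr z≁x z≁r (u≁ᶻ r) y≁x (₁≁ᶻ x r)

      -- If `z` missed `r′`, spiders centred at `y` would put the trace of `y` inside that of `z`.
      -- Some `x` in `L₁` is then missed by both, and `transfer` applies.
      shared : ∀ {y z r r′} → L₂ y → L₂ z → Z r → y ~ r → z ~ r → Z r′ → y ~ r′ → z ~ r′
      shared {y} {z} y₂@(_ , _ , t , t₁ , yt) z₂ r yr zr r′ yr′ = stable λ z≁r′ →
        let sub : ∀ {t} → L₁ t → y ~ t → z ~ t
            sub (_ , ut) yt = stable λ z≁t →
              spider yr′ yt (symm ut) yr (symm zr) (flip (u≁ᶻ r′)) (flip z≁r′) (flip z≁t) (flip (u≁ᶻ r)) (u≁₂ z₂)
            x , x₁ , z≁x = outside₂ z₂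
        in z≁r′ (transfer t₁ yt (sub t₁ yt) x₁ (z≁x ∘ sub x₁) z≁x r′ yr′)

    -- Two of the neighbours a₁, a₂, a₃ of u agree on Q; not being twins, they are told apart by some p.

    record Split (Q : Pred (Fin n) 0ℓ) : Set where
      field
        {t t′ p} : Fin n
        t₁   : L₁ t
        t′₁  : L₁ t′
        p₂   : L₂ p
        pt   : p ~ t
        p≁t′ : p ≁ t′
        alike : (Q t × Q t′) ⊎ (¬ Q t × ¬ Q t′)

    split : ∀ {Q} → Decidable Q → Split Q
    split {Q} Q? = choose (Q? a₁) (Q? a₂) (Q? a₃)
      where
      pair : ∀ {a a′} → L₁ a → L₁ a′ → a ≢ a′ → (Q a × Q a′) ⊎ (¬ Q a × ¬ Q a′) → Split Q
      pair {a} {a′} a₁@(a∈ , ua) a′₁@(a′∈ , ua′) a≢a′ same with twin-free a∈ a′∈ u∈U a≢a′ ua ua′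
      ... | p , p∈ , inj₁ (pa , p≁a′) = record
        { t₁ = a₁ ; t′₁ = a′₁ ; p₂ = p∈ , (λ { refl → p≁a′ ua′ }) , a , a₁ , pa
        ; pt = pa ; p≁t′ = p≁a′ ; alike = same }
      ... | p , p∈ , inj₂ (pa′ , p≁a) = record
        { t₁ = a′₁ ; t′₁ = a₁ ; p₂ = p∈ , (λ { refl → p≁a ua }) , a′ , a′₁ , pa′
        ; pt = pa′ ; p≁t′ = p≁a
        ; alike = Sum.map (λ { (q , q′) → q′ , q }) (λ { (q , q′) → q′ , q }) same }

      choose : Dec (Q a₁) → Dec (Q a₂) → Dec (Q a₃) → Split Q
      choose (yes q₁) (yes q₂) _        = pair (a₁∈U , ua₁) (a₂∈U , ua₂) a₁≢a₂ (inj₁ (q₁ , q₂))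
      choose (yes q₁) (no  _ ) (yes q₃) = pair (a₁∈U , ua₁) (a₃∈U , ua₃) a₁≢a₃ (inj₁ (q₁ , q₃))
      choose (yes _ ) (no  q₂) (no  q₃) = pair (a₂∈U , ua₂) (a₃∈U , ua₃) a₂≢a₃ (inj₂ (q₂ , q₃))
      choose (no  q₁) (no  q₂) _        = pair (a₁∈U , ua₁) (a₂∈U , ua₂) a₁≢a₂ (inj₂ (q₁ , q₂))
      choose (no  q₁) (yes _ ) (no  q₃) = pair (a₁∈U , ua₁) (a₃∈U , ua₃) a₁≢a₃ (inj₂ (q₁ , q₃))
      choose (no  _ ) (yes q₂) (yes q₃) = pair (a₂∈U , ua₂) (a₃∈U , ua₃) a₂≢a₃ (inj₁ (q₂ , q₃))

    abstract

      -- This ends the layering at `L₄`: every neighbour of `e` in `Z` is also adjacent to `m`,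
      -- hence lies in `L₃`. Otherwise two neighbours of `u` alike for `m`, and the `p` telling them
      -- apart, yield a spider at `b` or `m`.
      deep-neighbour : ∀ {m b e b′} → L₂ m → Z b → m ~ b → Z e → (∀ y → L₂ y → e ≁ y) → e ~ b →
                       Z b′ → e ~ b′ → m ~ b′
      deep-neighbour {m} {b} {e} {b′} m₂@(_ , _ , r , r₁ , mr) bᶻ mb eᶻ e≁ eb b′ᶻ eb′ = stable λ m≁b′ → refute m≁b′ (split (m ~?_))
        where
        refute : m ≁ b′ → ¬ Split (m ~_)
        refute m≁b′ record { t = t ; t′ = t′ ; p = p ; t₁ = t₁ ; t′₁ = t′₁ ; p₂ = p₂ ; pt = pt ; p≁t′ = p≁t′ ; alike = inj₁ (mt , mt′) }
          with p ~? b
        ... | yes pb = spider (symm pb) (symm mb) mt′ (symm eb) eb′ p≁t′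
                         (λ pb′ → m≁b′ (shared p₂ m₂ bᶻ pb mb b′ᶻ pb′)) m≁b′ (flip (₁≁ᶻ t′₁ eᶻ)) (₁≁ᶻ t′₁ b′ᶻ)
        ... | no p≁b = spider mt′ mt (symm pt) mb (symm eb) (flip p≁t′) (₁≁ᶻ t′₁ eᶻ) (₁≁ᶻ t₁ eᶻ) (flip p≁b) (flip (e≁ p p₂))
        refute m≁b′ record { t = x ; t′ = x′ ; p = p ; t₁ = x₁ ; t′₁ = x′₁ ; p₂ = p₂ ; pt = px ; p≁t′ = p≁x′ ; alike = inj₂ (m≁x , m≁x′) } =
          spider (symm mb) (symm pb) px (symm eb) eb′ m≁x m≁b′
            (λ pb′ → m≁b′ (shared p₂ m₂ bᶻ pb mb b′ᶻ pb′)) (flip (₁≁ᶻ x₁ eᶻ)) (₁≁ᶻ x₁ b′ᶻ)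
          where
          pr : p ~ r
          pr = stable λ p≁r → cross-free m₂ p₂ r₁ mr p≁r x₁ px m≁x x′₁ m≁x′ p≁x′
          pb : p ~ b
          pb = transfer r₁ mr pr x′₁ m≁x′ p≁x′ bᶻ mb

      -- A common neighbour in `L₁` would give a pentagon or a spider (`meet`), so the traces of `m`
      -- and `m′` are disjoint, and by cross-freeness they cover `L₁`. A vertex `p` that splits one
      -- of the traces then meets its owner in the same forbidden way (`core`).
      no-private-pair : ∀ {m m′ b b′} → L₂ m → L₂ m′ → Z b → Z b′ → m ~ b → m′ ~ b′ → m ≁ b′ → m′ ≁ b → ⊥
      no-private-pair m₂ m′₂ bᶻ b′ᶻ mb m′b′ m≁b′ m′≁b = finish m₂ m′₂ bᶻ b′ᶻ mb m′b′ m≁b′ m′≁b (split (_ ~?_))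
        where
        meet : ∀ {m m′ b b′ t} → L₂ m → L₂ m′ → Z b → Z b′ → m ~ b → m′ ~ b′ → m ≁ b′ → m′ ≁ b →
               L₁ t → m ~ t → m′ ≁ t
        meet {b = b} {b′} m₂ m′₂ bᶻ b′ᶻ mb m′b′ m≁b′ m′≁b (t∈ , ut) mt m′t with b ~? b′
        ... | yes bb′ = pentagon-free t∈ (proj₁ m₂) (proj₁ bᶻ) (proj₁ b′ᶻ) (proj₁ m′₂)
                          (pentagon (symm mt) mb bb′ (symm m′b′) m′t)
        ... | no b≁b′ = spider (symm ut) (symm mt) mb (symm m′t) m′b′ (u≁ᶻ bᶻ) (u≁ᶻ b′ᶻ) m≁b′ m′≁b b≁b′

        core : ∀ {m m′ b b′ t t′ p} → L₂ m → L₂ m′ → Z b → Z b′ → m ~ b → m′ ~ b′ → m ≁ b′ → m′ ≁ b →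
               L₁ t → L₁ t′ → m ~ t → m ~ t′ → L₂ p → p ~ t → p ≁ t′ → ⊥
        core {m} {m′} {b} {b′} {t} {t′} {p} m₂ m′₂@(_ , _ , r , r₁ , m′r) bᶻ b′ᶻ mb m′b′ m≁b′ m′≁b t₁ t′₁ mt mt′ p₂ pt p≁t′ =
          clash (b ~? b′)
          where
          m′≁ : ∀ {t} → L₁ t → m ~ t → m′ ≁ t
          m′≁ = meet m₂ m′₂ bᶻ b′ᶻ mb m′b′ m≁b′ m′≁b
          pr : p ~ r
          pr = stable λ p≁r → cross-free p₂ m′₂ t₁ pt (m′≁ t₁ mt) r₁ m′r p≁r t′₁ p≁t′ (m′≁ t′₁ mt′)
          pb′ : p ~ b′
          pb′ = transfer r₁ m′r pr t′₁ (m′≁ t′₁ mt′) p≁t′ b′ᶻ m′b′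
          p≁b : p ≁ b
          p≁b pb = m≁b′ (shared p₂ m₂ bᶻ pb mb b′ᶻ pb′)
          clash : ¬ Dec (b ~ b′)
          clash (yes bb′) = pentagon-free (proj₁ t₁) (proj₁ m₂) (proj₁ bᶻ) (proj₁ b′ᶻ) (proj₁ p₂)
                              (pentagon (symm mt) mb bb′ (symm pb′) pt)
          clash (no b≁b′) = spider (symm (proj₂ t₁)) (symm mt) mb (symm pt) pb′ (u≁ᶻ bᶻ) (u≁ᶻ b′ᶻ) m≁b′ p≁b b≁b′

        finish : ∀ {m m′ b b′} → L₂ m → L₂ m′ → Z b → Z b′ → m ~ b → m′ ~ b′ → m ≁ b′ → m′ ≁ b → ¬ Split (m ~_)
        finish m₂ m′₂ bᶻ b′ᶻ mb m′b′ m≁b′ m′≁b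
          record { t₁ = t₁ ; t′₁ = t′₁ ; p₂ = p₂ ; pt = pt ; p≁t′ = p≁t′ ; alike = inj₁ (mt , mt′) } =
          core m₂ m′₂ bᶻ b′ᶻ mb m′b′ m≁b′ m′≁b t₁ t′₁ mt mt′ p₂ pt p≁t′
        finish {m} {m′} m₂@(_ , _ , r , r₁ , mr) m′₂@(_ , _ , r′ , r′₁ , m′r′) bᶻ b′ᶻ mb m′b′ m≁b′ m′≁b
          record { t₁ = t₁ ; t′₁ = t′₁ ; p₂ = p₂ ; pt = pt ; p≁t′ = p≁t′ ; alike = inj₂ (m≁t , m≁t′) } =
          core m′₂ m₂ b′ᶻ bᶻ m′b′ mb m′≁b m≁b′ t₁ t′₁ (covering t₁ m≁t) (covering t′₁ m≁t′) p₂ pt p≁t′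
          where
          covering : ∀ {x} → L₁ x → m ≁ x → m′ ~ x
          covering x₁ m≁x = stable λ m′≁x →
            cross-free m₂ m′₂ r₁ mr (meet m₂ m′₂ bᶻ b′ᶻ mb m′b′ m≁b′ m′≁b r₁ mr)
              r′₁ m′r′ (meet m′₂ m₂ b′ᶻ bᶻ m′b′ mb m′≁b m≁b′ r′₁ m′r′) x₁ m≁x m′≁x

      -- Let `m` be a neighbour of `b` in `L₂`. Either `m` sees `b′`, and `shared` applies, or `m`
      -- and a `y` missing `b` form a private pair.
      complete₂ : ∀ {y b b′} → L₂ y → Z b′ → y ~ b′ → L₃ b → y ~ b
      complete₂ y₂ b′ᶻ yb′ (bᶻ , m , m₂ , mb) = stable λ y≁b →
        no-private-pair m₂ y₂ bᶻ b′ᶻ mb yb′ (λ mb′ → y≁b (shared m₂ y₂ b′ᶻ mb′ yb′ bᶻ mb)) y≁b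

      independent₃ : ∀ {b b′} → L₃ b → L₃ b′ → b ≁ b′
      independent₃ b₃@(_ , m , m₂ , mb) b′₃@(b′ᶻ , _) bb′ =
        △ bb′ (symm mb) (symm (complete₂ m₂ (proj₁ b₃) mb b′₃))

      -- Otherwise there is a spider centred at `y` with short leg `b′` and long legs `t`, `u` and
      -- `b`, `e`.
      complete₄ : ∀ {e b′} → L₄ e → L₃ b′ → e ~ b′
      complete₄ {e} (eᶻ , e≁ , b , b₃@(bᶻ , y , y₂@(_ , _ , t , t₁ , yt) , yb) , eb) b′₃@(b′ᶻ , _) = stable λ e≁b′ →
        spider (complete₂ y₂ bᶻ yb b′₃) yt (symm (proj₂ t₁)) yb (symm eb)
          (flip (u≁ᶻ b′ᶻ)) (flip e≁b′) (₁≁ᶻ t₁ eᶻ) (flip (u≁ᶻ bᶻ)) (u≁ᶻ eᶻ)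

    data Layer (v : Fin n) : Set where
      root : v ≡ u → Layer v
      one   : L₁ v → Layer v
      two   : L₂ v → Layer v
      three : L₃ v → Layer v
      four  : L₄ v → Layer v
      far   : Far v → Layer v

    abstract

      layer : ∀ {v} → v ∈ U → Layer v
      layer {v} v∈U with v ≟ u
      ... | yes v≡u = root v≡u
      ... | no  v≢u with u ~? v
      ...   | yes uv = one (v∈U , uv)
      ...   | no u≁v with L₂? v
      ...     | yes v₂ = two v₂
      ...     | no ¬v₂ = layerᶻ (v∈U , v≢u , u≁v , λ a a₁ va → ¬v₂ (v∈U , v≢u , a , a₁ , va))
        where
        layerᶻ : Z v → Layer v
        layerᶻ vᶻ with any? (λ y → L₂? y ×-dec v ~? y)
        ... | yes (y , y₂ , vy) = three (vᶻ , y , y₂ , symm vy)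
        ... | no none with any? (λ b → L₃? b ×-dec v ~? b)
        ...   | yes (b , b₃ , vb) = four (vᶻ , (λ y y₂ vy → none (y , y₂ , vy)) , b , b₃ , vb)
        ...   | no none′ = far (vᶻ , (λ y y₂ vy → none (y , y₂ , vy)) , λ b b₃ vb → none′ (b , b₃ , vb))

    inherit₃ : ∀ {b b′ z} → L₃ b → L₃ b′ → z ∈ U → z ~ b → z ~ b′
    inherit₃ b₃@(bᶻ , _) b′₃ z∈U zb with layer z∈U
    ... | root refl           = contradiction zb (u≁ᶻ bᶻ)
    ... | one z₁              = contradiction zb (₁≁ᶻ z₁ bᶻ)
    ... | two z₂              = complete₂ z₂ bᶻ zb b′₃
    ... | three z₃            = contradiction zb (independent₃ z₃ b₃)
    ... | four z₄             = complete₄ z₄ b′₃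
    ... | far (_ , _ , z≁)    = contradiction zb (z≁ _ b₃)

    -- By `inherit₃` all vertices of `L₃` have the same neighbours, and they share a neighbour in
    -- `L₂`; two of them would be twins.
    unique₃ : ∀ {b b′} → L₃ b → L₃ b′ → b ≡ b′
    unique₃ {b} {b′} b₃@(bᶻ , y , y₂ , yb) b′₃ with b ≟ b′
    ... | yes b≡b′ = b≡b′
    ... | no  b≢b′
      with twin-free (proj₁ bᶻ) (proj₁ (proj₁ b′₃)) (proj₁ y₂) b≢b′ yb (complete₂ y₂ bᶻ yb b′₃)
    ...   | z , z∈U , inj₁ (zb , z≁b′) = contradiction (inherit₃ b₃ b′₃ z∈U zb) z≁b′
    ...   | z , z∈U , inj₂ (zb′ , z≁b) = contradiction (inherit₃ b′₃ b₃ z∈U zb′) z≁b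

    -- If both missed `x`, then by `transfer` their traces would be disjoint, as `b` tells `w` and
    -- `y` apart; this contradicts cross-freeness.
    covered : ∀ {w y b x} → L₂ w → L₂ y → Z b → w ≁ b → y ~ b → L₁ x → y ≁ x → w ~ x
    covered {w} {y} {b} w₂@(_ , _ , t′ , t′₁ , wt′) y₂@(_ , _ , t , t₁ , yt) bᶻ w≁b yb x₁ y≁x =
      stable λ w≁x →
        let meet : ∀ {t} → L₁ t → y ~ t → w ≁ t
            meet t₁ yt wt = w≁b (transfer t₁ yt wt x₁ y≁x w≁x bᶻ yb)
        in cross-free y₂ w₂ t₁ yt (meet t₁ yt) t′₁ wt′ (λ yt′ → meet t′₁ yt′ wt′) x₁ y≁x w≁x

    -- Given a vertex of `L₄`, the traces of a vertex missing `b` and of one seeing `b` partition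
    -- `L₁` (`covered` and `apart`). So every trace is one of two complementary sets, and no vertex
    -- can split two neighbours of `u` on the same side.
    no-four : ∀ {w e b} → L₃ b → L₂ w → w ≁ b → ¬ L₄ e
    no-four {w} {e} {b} b₃@(bᶻ , m , m₂ , mb) w₂ w≁b e₄@(eᶻ , e≁ , _) = refute (split (m ~?_))
      where
      apart : ∀ {w m t} → L₂ w → w ≁ b → L₂ m → m ~ b → L₁ t → m ~ t → w ≁ t
      apart w₂ w≁b m₂ mb t₁ mt wt =
        let x , x₁ , w≁x = outside₂ w₂
            mx = stable (w≁x ∘ covered w₂ m₂ bᶻ w≁b mb x₁)
        in spider mx mt (symm wt) mb (symm (complete₄ e₄ b₃)) (flip w≁x) (₁≁ᶻ x₁ eᶻ) (₁≁ᶻ t₁ eᶻ)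
             (flip w≁b) (flip (e≁ _ w₂))

      refute : ¬ Split (m ~_)
      refute record { p = p ; t₁ = t₁ ; t′₁ = t′₁ ; p₂ = p₂ ; pt = pt ; p≁t′ = p≁t′ ; alike = inj₁ (mt , mt′) }
        with p ~? b
      ... | yes pb = apart w₂ w≁b m₂ mb t′₁ mt′ (covered w₂ p₂ bᶻ w≁b pb t′₁ p≁t′)
      ... | no p≁b = apart p₂ p≁b m₂ mb t₁ mt pt
      refute record { p = p ; t₁ = t₁ ; t′₁ = t′₁ ; p₂ = p₂ ; pt = pt ; p≁t′ = p≁t′ ; alike = inj₂ (m≁t , m≁t′) }
        with p ~? b
      ... | yes pb = apart w₂ w≁b p₂ pb t₁ pt (covered w₂ m₂ bᶻ w≁b mb t₁ m≁t)
      ... | no p≁b = p≁t′ (covered p₂ m₂ bᶻ p≁b mb t′₁ m≁t′)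

    far-apart : ∀ {s t} → s ∈ U → t ∈ U → Far s → ¬ Far t → s ≁ t
    far-apart _ t∈U (sᶻ , s≁₂ , s≁₃) ¬far st with layer t∈U
    ... | root refl  = u≁ᶻ sᶻ (symm st)
    ... | one t₁     = ₁≁ᶻ t₁ sᶻ (symm st)
    ... | two t₂     = s≁₂ _ t₂ st
    ... | three t₃   = s≁₃ _ t₃ st
    ... | four (tᶻ , t≁ , b , (bᶻ , m , m₂ , mb) , tb) =
      s≁₂ _ m₂ (symm (deep-neighbour m₂ bᶻ mb tᶻ t≁ tb sᶻ (symm st)))
    ... | far t      = ¬far t

    -- The odd layers, one class of the bipartition once `Far` is empty.
    White : Pred (Fin n) 0ℓ
    White v = L₁ v ⊎ L₃ v

    White? : Decidable White
    White? v = L₁? v ⊎-dec L₃? v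

    module _ (¬far : ∀ {v} → ¬ Far v) where

      data Side (v : Fin n) : Set where
        white : White v → Side v
        black : ¬ White v → v ≡ u ⊎ L₂ v ⊎ L₄ v → Side v

      side : ∀ {v} → v ∈ U → Side v
      side v∈U with layer v∈U
      ... | root refl = black [ irrefl refl ∘ proj₂ , (λ { ((_ , u≢u , _) , _) → u≢u refl }) ]′ (inj₁ refl)
      ... | one v₁    = white (inj₁ v₁)
      ... | two v₂    = black [ u≁₂ v₂ ∘ proj₂ , (λ { ((_ , _ , _ , v≁) , _) → let _ , _ , a , a₁ , va = v₂ in v≁ a a₁ va }) ]′
                          (inj₂ (inj₁ v₂))
      ... | three v₃  = white (inj₂ v₃)
      ... | four v₄@(vᶻ , v≁ , _)  = black [ u≁ᶻ vᶻ ∘ proj₂ , (λ { (_ , y , y₂ , yv) → v≁ y y₂ (symm yv) }) ]′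
                          (inj₂ (inj₂ v₄))
      ... | far v     = contradiction v ¬far

      white-independent : ∀ {s t} → White s → White t → s ≁ t
      white-independent (inj₁ (_ , us)) (inj₁ (_ , ut)) = △ us ut
      white-independent (inj₁ s₁)       (inj₂ (tᶻ , _)) = ₁≁ᶻ s₁ tᶻ
      white-independent (inj₂ (sᶻ , _)) (inj₁ t₁)       = flip (₁≁ᶻ t₁ sᶻ)
      white-independent (inj₂ s₃)       (inj₂ t₃)       = independent₃ s₃ t₃

      black-independent : ∀ {s t} → s ≡ u ⊎ L₂ s ⊎ L₄ s → t ≡ u ⊎ L₂ t ⊎ L₄ t → s ≁ t
      black-independent (inj₁ refl)      (inj₁ refl)      = irrefl refl
      black-independent (inj₁ refl)      (inj₂ (inj₁ t₂)) = u≁₂ t₂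
      black-independent (inj₁ refl)      (inj₂ (inj₂ t₄)) = u≁ᶻ (proj₁ t₄)
      black-independent (inj₂ (inj₁ s₂)) (inj₁ refl)      = flip (u≁₂ s₂)
      black-independent (inj₂ (inj₂ s₄)) (inj₁ refl)      = flip (u≁ᶻ (proj₁ s₄))
      black-independent (inj₂ (inj₁ s₂)) (inj₂ (inj₁ t₂)) = independent₂ s₂ t₂
      black-independent (inj₂ (inj₁ s₂)) (inj₂ (inj₂ (_ , t≁ , _))) = flip (t≁ _ s₂)
      black-independent (inj₂ (inj₂ (_ , s≁ , _))) (inj₂ (inj₁ t₂)) = s≁ _ t₂
      black-independent (inj₂ (inj₂ s₄@(_ , _ , b , b₃ , sb))) (inj₂ (inj₂ t₄)) =
        △ (symm sb) (symm (complete₄ t₄ b₃))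

      bipartite : ∀ {s t} → s ∈ U → t ∈ U → s ~ t → (White s × ¬ White t) ⊎ (¬ White s × White t)
      bipartite s∈U t∈U st with side s∈U | side t∈U
      ... | white ws    | white wt    = contradiction st (white-independent ws wt)
      ... | white ws    | black ¬wt _ = inj₁ (ws , ¬wt)
      ... | black ¬ws _ | white wt    = inj₂ (¬ws , wt)
      ... | black _ bs  | black _ bt  = contradiction st (black-independent bs bt)

      module _ {col : Fin n → Bool} (proper : Proper U col) where

        opposite : ∀ {s t} → s ∈ U → t ∈ U → s ~ t → col t ≡ not (col s)
        opposite s∈ t∈ st = ¬-not (proper t∈ s∈ (symm st))

        opposite² : ∀ {s t v} → s ∈ U → t ∈ U → v ∈ U → s ~ t → t ~ v → col v ≡ col s
        opposite² s∈ t∈ v∈ st tv =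
          trans (opposite t∈ v∈ tv) (trans (cong not (opposite s∈ t∈ st)) (not-involutive _))

        colour₂ : ∀ {y} → L₂ y → col y ≡ col u
        colour₂ (y∈ , _ , a , (a∈ , ua) , ya) = opposite² u∈U a∈ y∈ ua (symm ya)

        colour₃ : ∀ {b} → L₃ b → col b ≡ not (col u)
        colour₃ (bᶻ , y , y₂ , yb) = trans (opposite (proj₁ y₂) (proj₁ bᶻ) yb) (cong not (colour₂ y₂))

        -- Without `Far` vertices everything is joined to `u` by a path through the layers, along
        -- which the colours alternate.
        rigid : ∀ {s} → s ∈ U → (White s → col s ≡ not (col u)) × (¬ White s → col s ≡ col u)
        rigid s∈U with side s∈U
        ... | white (inj₁ (_ , us)) = (λ _ → opposite u∈U s∈U us) , contradiction (inj₁ (s∈U , us))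
        ... | white (inj₂ s₃)       = (λ _ → colour₃ s₃) , contradiction (inj₂ s₃)
        ... | black ¬w (inj₁ refl)  = (λ w → contradiction w ¬w) , λ _ → refl
        ... | black ¬w (inj₂ (inj₁ s₂)) = (λ w → contradiction w ¬w) , λ _ → colour₂ s₂
        ... | black ¬w (inj₂ (inj₂ (sᶻ , _ , b , b₃ , sb))) = (λ w → contradiction w ¬w) , λ _ →
          trans (opposite (proj₁ (proj₁ b₃)) s∈U (symm sb)) (trans (cong not (colour₃ b₃)) (not-involutive _))

      -- With `L₃` empty, `u` is adjacent to the whole opposite class, so it is isolated in the
      -- bipartite complement.
      series-root : (∀ {b} → ¬ L₃ b) → Decomposition U u
      series-root ¬L₃ = series White? (_≟ u) bipartite rigid u∈U refl a₁∈U
        (λ { refl → irrefl refl ua₁ }) link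
        where
        link : ∀ {s t} → s ∈ U → t ∈ U → s ≡ u → t ≢ u → (White s × ¬ White t) ⊎ (¬ White s × White t) → s ~ t
        link _ _ refl _ (inj₁ (inj₁ (_ , uu) , _)) = contradiction uu (irrefl refl)
        link _ _ refl _ (inj₁ (inj₂ u₃ , _))       = contradiction u₃ ¬L₃
        link _ _ refl _ (inj₂ (_ , inj₁ (_ , ut))) = ut
        link _ _ refl _ (inj₂ (_ , inj₂ t₃))       = contradiction t₃ ¬L₃

      module _ {b : Fin n} (b₃ : L₃ b) where

        -- The neighbours of `b` together with the vertices of `L₁` that some neighbour of `b`
        -- misses. This set is closed under adjacency in the bipartite complement and leaves out
        -- `u`.
        Part : Pred (Fin n) 0ℓ
        Part v = b ~ v ⊎ (L₁ v × ∃ λ y → y ∈ U × b ~ y × y ≁ v)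

        Part? : Decidable Part
        Part? v = b ~? v ⊎-dec (L₁? v ×-dec any? λ y → y ∈? U ×-dec b ~? y ×-dec ¬? (y ~? v))

        link : ∀ {s t} → s ∈ U → t ∈ U → Part s → ¬ Part t →
               (White s × ¬ White t) ⊎ (¬ White s × White t) → s ~ t
        link s∈U t∈U (inj₁ bs) ¬Pt (inj₁ (ws , _)) = contradiction bs (white-independent (inj₂ b₃) ws)
        link s∈U t∈U (inj₁ bs) ¬Pt (inj₂ (_ , inj₁ t₁)) =
          stable λ s≁t → ¬Pt (inj₂ (t₁ , _ , s∈U , bs , s≁t))
        link s∈U t∈U (inj₁ bs) ¬Pt (inj₂ (_ , inj₂ t₃)) = subst (_ ~_) (unique₃ b₃ t₃) (symm bs)
        link s∈U t∈U (inj₂ (s₁ , _)) ¬Pt (inj₂ (¬ws , _)) = contradiction (inj₁ s₁) ¬ws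
        link s∈U t∈U (inj₂ (s₁ , y , y∈U , by , y≁s)) ¬Pt (inj₁ (_ , ¬wt)) with side t∈U
        ... | white wt = contradiction wt ¬wt
        ... | black _ (inj₁ refl) = symm (proj₂ s₁)
        ... | black _ (inj₂ (inj₂ t₄)) = contradiction (inj₁ (symm (complete₄ t₄ b₃))) ¬Pt
        ... | black _ (inj₂ (inj₁ t₂)) with side y∈U
        ...   | white wy = contradiction by (white-independent (inj₂ b₃) wy)
        ...   | black _ (inj₁ refl) = contradiction (proj₂ s₁) y≁s
        ...   | black _ (inj₂ (inj₁ y₂)) =
          symm (covered t₂ y₂ (proj₁ b₃) (λ tb → ¬Pt (inj₁ (symm tb))) (symm by) s₁ y≁s)
        ...   | black _ (inj₂ (inj₂ y₄)) = contradiction y₄ (no-four b₃ t₂ (λ tb → ¬Pt (inj₁ (symm tb))))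

        series-three : Decomposition U u
        series-three = let bᶻ , _ , m₂ , mb = b₃ in
          series White? Part? bipartite rigid (proj₁ m₂) (inj₁ (symm mb)) u∈U
            [ u≁ᶻ bᶻ ∘ symm , irrefl refl ∘ proj₂ ∘ proj₁ ]′ link

    decomposition : Decomposition U u
    decomposition with any? Far?
    ... | yes (v , v-far) = parallel Far? (proj₁ (proj₁ v-far)) v-far u∈U
                              (λ { ((_ , u≢u , _) , _) → u≢u refl }) far-apart
    ... | no ¬far with any? L₃?
    ...   | yes (b , b₃) = series-three (λ f → ¬far (_ , f)) b₃
    ...   | no ¬L₃ = series-root (λ f → ¬far (_ , f)) (λ b₃ → ¬L₃ (_ , b₃))

-- Graphs with a pentagon

module Champion {X : Set} (Q : Pred X 0ℓ) (kind : X → Fin 3) (_≻_ : X → X → Set)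
  (_≻?_ : ∀ x y → Dec (x ≻ y))
  (total : ∀ {x y} → kind x ≢ kind y → x ≻ y ⊎ y ≻ x)
  (≻-trans : ∀ {x y z} → Q x → Q y → Q z → kind x ≢ kind z → x ≻ y → y ≻ z → x ≻ z)
  (no-square : ∀ {x y x′ y′} → Q x → Q y → Q x′ → Q y′ → kind x ≡ kind x′ → kind y ≡ kind y′ →
               x ≻ y → y ≻ x′ → x′ ≻ y′ → y′ ≻ x → ⊥)
  where

  Best : X → List X → Set
  Best z xs = z List.∈ xs × (∀ {y} → y List.∈ xs → kind y ≢ kind z → z ≻ y)

  -- Let `y` meet the champion `m` of the rest. If `y` beats `m`, transitivity makes `y` beat all
  -- kinds except possibly that of `m`. A vertex `w` of that kind beating `y` wins instead: it beats
  -- the third kind by transitivity through `y` and `m`, and the kind of `y` because there is no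
  -- square.
  champion : ∀ x xs → All Q (x ∷ xs) → ∃ λ z → Best z (x ∷ xs)
  champion x [] _ = x , here refl , λ { (here refl) ne → contradiction refl ne }
  champion y (x ∷ xs) (qy ∷ qs) with champion x xs qs
  ... | m , m∈ , best with kind y ≟ kind m
  ...   | yes same = m , there m∈ , λ { (here refl) ne → contradiction same ne ; (there z∈) ne → best z∈ ne }
  ...   | no differ with total differ
  ...     | inj₂ m≻y = m , there m∈ , λ { (here refl) _ → m≻y ; (there z∈) ne → best z∈ ne }
  ...     | inj₁ y≻m with Any.any? (λ x → kind x ≟ kind m ×-dec x ≻? y) (x ∷ xs)
  ...       | no none = y , here refl , beats
    where
    beats : ∀ {z} → z List.∈ (y ∷ x ∷ xs) → kind z ≢ kind y → y ≻ z
    beats (here refl) ne = contradiction refl ne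
    beats {z} (there z∈) ne with kind z ≟ kind m
    ... | no  ne′ = ≻-trans qy (All.lookup qs m∈) (All.lookup qs z∈) (ne ∘ sym) y≻m (best z∈ ne′)
    ... | yes eq with total ne
    ...   | inj₁ z≻y = contradiction (List.lose z∈ (eq , z≻y)) none
    ...   | inj₂ y≻z = y≻z
  ...       | yes some with w , w∈ , same , w≻y ← List.find some = w , there w∈ , beats
    where
    beats : ∀ {z} → z List.∈ (y ∷ x ∷ xs) → kind z ≢ kind w → w ≻ z
    beats (here refl) _ = w≻y
    beats {z} (there z∈) ne with kind z ≟ kind y | best z∈ (λ eq → ne (trans eq (sym same)))
    ... | no ne′ | m≻z = ≻-trans (All.lookup qs w∈) qy (All.lookup qs z∈) (ne ∘ sym) w≻y
                          (≻-trans qy (All.lookup qs m∈) (All.lookup qs z∈) (ne′ ∘ sym) y≻m m≻z)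
    ... | yes eq | m≻z with total ne
    ...   | inj₂ w≻z = w≻z
    ...   | inj₁ z≻w = ⊥-elim (no-square (All.lookup qs w∈) qy (All.lookup qs m∈) (All.lookup qs z∈)
                                 same (sym eq) w≻y y≻m m≻z z≻w)

-- In group m, plus vertices can replace corner 2 + m of the pentagon, minus vertices corner 3 + m,
-- and pend vertices hang on corner m.

pattern plus = 0F
pattern pend = 1F
pattern minus = 2F

data Next : Fin 3 → Fin 3 → Set where
  plus→pend : Next plus pend
  pend→minus : Next pend minus
  minus→plus : Next minus plus

next? : ∀ κ κ′ → Dec (Next κ κ′)
next? plus pend = yes plus→pend
next? pend minus = yes pend→minus
next? minus plus = yes minus→plus
next? plus plus = no λ ()
next? plus minus = no λ ()
next? pend plus = no λ ()
next? pend pend = no λ ()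
next? minus pend = no λ ()
next? minus minus = no λ ()

next-total : ∀ {κ κ′} → κ ≢ κ′ → Next κ κ′ ⊎ Next κ′ κ
next-total {plus} {plus} ne = contradiction refl ne
next-total {plus} {pend} _  = inj₁ plus→pend
next-total {plus} {minus} _  = inj₂ minus→plus
next-total {pend} {plus} _  = inj₂ plus→pend
next-total {pend} {pend} ne = contradiction refl ne
next-total {pend} {minus} _  = inj₁ pend→minus
next-total {minus} {plus} _  = inj₁ minus→plus
next-total {minus} {pend} _  = inj₂ pend→minus
next-total {minus} {minus} ne = contradiction refl ne

module AroundPentagon (G : Graph) (free : ((｛ S₁₂₂ ｝ ∪ ｛ K₃ ｝) -Free) G) where

  open Forbidden G free
  open Structure G free
  open Building G

  module _ {a b c d e : Fin n} (cycle : Pentagon a b c d e) where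

    -- Indexing the pentagon periodically by ℕ makes its rotations hold by computation.

    corner : ℕ → Fin n
    corner 0 = a
    corner 1 = b
    corner 2 = c
    corner 3 = d
    corner 4 = e
    corner (suc (suc (suc (suc (suc m))))) = corner m

    side : ∀ m → corner m ~ corner (1 + m)
    side 0 = Pentagon.ab cycle
    side 1 = Pentagon.bc cycle
    side 2 = Pentagon.cd cycle
    side 3 = Pentagon.de cycle
    side 4 = Pentagon.ea cycle
    side (suc (suc (suc (suc (suc m))))) = side m

    chord : ∀ m → corner m ≁ corner (2 + m)
    chord m = △ (symm (side m)) (side (1 + m))

    -- Two m holds the vertices that could replace corner (1 + m) in the pentagon.

    Two One : ℕ → Pred (Fin n) 0ℓ
    Two m v = v ~ corner m × v ~ corner (2 + m)
    One m v = v ~ corner m × v ≁ corner (2 + m) × v ≁ corner (3 + m)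

    two? : ∀ m → Decidable (Two m)
    two? m v = v ~? corner m ×-dec v ~? corner (2 + m)

    one? : ∀ m → Decidable (One m)
    one? m v = v ~? corner m ×-dec ¬? (v ~? corner (2 + m)) ×-dec ¬? (v ~? corner (3 + m))

    two≁ : ∀ {m v} → Two m v → v ≁ corner (1 + m)
    two≁ {m} (v0 , _) = △ (symm v0) (side m)

    two≁′ : ∀ {m v} → Two m v → v ≁ corner (3 + m)
    two≁′ {m} (_ , v2) = △ (symm v2) (side (2 + m))

    two≁″ : ∀ {m v} → Two m v → v ≁ corner (4 + m)
    two≁″ {m} (v0 , _) = △ (symm v0) (symm (side (4 + m)))

    one≁ : ∀ {m v} → One m v → v ≁ corner (1 + m)
    one≁ {m} (v0 , _) = △ (symm v0) (side m)

    one≁′ : ∀ {m v} → One m v → v ≁ corner (4 + m)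
    one≁′ {m} (v0 , _) = △ (symm v0) (symm (side (4 + m)))

    share : ∀ {m v w} → v ~ corner m → w ~ corner m → v ≁ w
    share vm wm = △ (symm vm) (symm wm)

    abstract

      one-two : ∀ m {w v} → One m w → Two (4 + m) v → w ~ v
      one-two m (w0 , w≁2 , w≁3) v@(v4 , v1) = stable λ w≁v →
        spider (symm v1) (symm (side m)) (symm w0) (side (1 + m)) (side (2 + m))
          (flip w≁v) (two≁″ {4 + m} v) (flip (chord (3 + m))) (flip w≁2) w≁3

      one-one : ∀ m {w w′} → One m w → One (1 + m) w′ → w ~ w′
      one-one m (w0 , w≁2 , w≁3) w′@(w′1 , w′≁3 , w′≁4) = stable λ w≁w′ →
        spider (symm w0) (side m) (symm w′1) (symm (side (4 + m))) (symm (side (3 + m)))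
          w≁w′ w≁3 (chord (1 + m)) (flip w′≁4) w′≁3

      one-one′ : ∀ m {w w′} → One m w → One (2 + m) w′ → w ≁ w′
      one-one′ m (w0 , w≁2 , w≁3) w′@(w′2 , w′≁4 , w′≁0) ww′ =
        spider (side m) (symm w0) ww′ (symm (side (4 + m))) (symm (side (3 + m)))
          (flip (one≁′ {2 + m} w′)) (chord (1 + m)) w≁3 (flip w′≁4) (one≁ {2 + m} w′)

      -- A spider centred at `corner m`. A replacement of a corner is thus complete to the
      -- replacements of the corner before it whenever it misses one of those after it, and
      -- conversely.
      one-side : ∀ m {v v₁ v₄} → Two (4 + m) v → Two m v₁ → Two (3 + m) v₄ → v ≁ v₁ → v ≁ v₄ → ⊥
      one-side m v@(v4 , v1) v₁@(v₁0 , v₁2) v₄@(v₄3 , v₄0) v≁v₁ v≁v₄ =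
        spider (symm v₄0) (symm v₁0) v₁2 (symm (side (4 + m))) (symm v4)
          (two≁″ {3 + m} v₄) (flip v≁v₄) (flip v≁v₁) (flip (chord (2 + m))) (flip (two≁′ {4 + m} v))

      hook : ∀ m {v v₁ w} → Two (1 + m) v → Two m v₁ → One m w → v ≁ v₁ → v ≁ w
      hook m v@(v1 , v3) v₁@(v₁0 , v₁2) (w0 , w≁2 , _) v≁v₁ vw =
        spider (symm (side (4 + m))) (symm w0) (symm vw) (symm v₁0) v₁2
          (flip (two≁′ {1 + m} v)) (flip (chord (2 + m))) w≁2 (flip v≁v₁) (two≁ {1 + m} v)

      hook′ : ∀ m {v v₄ w} → Two (2 + m) v → Two (3 + m) v₄ → One m w → v ≁ v₄ → v ≁ w
      hook′ m v@(v2 , v4) v₄@(v₄3 , v₄0) (w0 , _ , w≁3) v≁v₄ vw =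
        spider (side m) (symm w0) (symm vw) (symm v₄0) v₄3
          (flip (two≁″ {2 + m} v)) (chord (1 + m)) w≁3 (flip v≁v₄) (two≁ {2 + m} v)

      -- Two independent edges between the kinds would be the long legs of a spider centred at a
      -- corner, with a neighbouring corner as short leg. The other two chain lemmas argue alike.
      chain-two : ∀ m {v v′ q q′} → Two (1 + m) v → Two (1 + m) v′ → Two (2 + m) q → Two (2 + m) q′ →
                  v ~ q → v′ ~ q′ → v ≁ q′ → v′ ≁ q → ⊥
      chain-two m v v′ (_ , q4) (_ , q′4) vq v′q′ v≁q′ v′≁q =
        spider (side (4 + m)) (symm q4) (symm vq) (symm q′4) (symm v′q′)
          (flip (two≁″ {1 + m} v)) (flip (two≁″ {1 + m} v′)) (flip v′≁q) (flip v≁q′) (share {1 + m} (proj₁ v) (proj₁ v′))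

      chain-one : ∀ m {v v′ w w′} → Two (1 + m) v → Two (1 + m) v′ → One m w → One m w′ →
                  v ~ w → v′ ~ w′ → v ≁ w′ → v′ ≁ w → ⊥
      chain-one m (v1 , _) (v′1 , _) (w0 , w≁2 , _) (w′0 , w′≁2 , _) vw v′w′ v≁w′ v′≁w =
        spider (side (1 + m)) (symm v1) vw (symm v′1) v′w′
          (flip w≁2) (flip w′≁2) v≁w′ v′≁w (share {m} w0 w′0)

      chain-one′ : ∀ m {w w′ q q′} → One m w → One m w′ → Two (2 + m) q → Two (2 + m) q′ →
                   w ~ q → w′ ~ q′ → w ≁ q′ → w′ ≁ q → ⊥
      chain-one′ m (w0 , _ , w≁3) (w′0 , _ , w′≁3) (_ , q4) (_ , q′4) wq w′q′ w≁q′ w′≁q =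
        spider (symm (side (3 + m))) (symm q4) (symm wq) (symm q′4) (symm w′q′)
          (flip w≁3) (flip w′≁3) (flip w′≁q) (flip w≁q′) (share {m} w0 w′0)

      no-independent : ∀ m {v w q} → Two (1 + m) v → One m w → Two (2 + m) q → v ≁ w → w ≁ q → v ≁ q → ⊥
      no-independent m v@(v1 , v3) (w0 , _) q@(q2 , q4) v≁w w≁q v≁q =
        spider (symm w0) (side m) (symm v1) (symm (side (4 + m))) (symm q4)
          (flip v≁w) w≁q (flip (two≁″ {2 + m} q)) (flip (two≁′ {1 + m} v)) v≁q

    -- The clauses on completeness and anticompleteness settle the adjacencies to neighbouring
    -- groups that a shared corner leaves open.
    Kind : Fin 3 → ℕ → Pred (Fin n) 0ℓ
    Kind plus m v = Two (1 + m) v × (∀ x → Two m x → v ~ x) × (∀ w → One (4 + m) w → v ≁ w)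
    Kind pend m v = One m v
    Kind minus m v = Two (2 + m) v × (∀ x → Two (3 + m) x → v ~ x) × (∀ w → One (1 + m) w → v ≁ w)

    -- If `v` misses a replacement `x` of the previous corner, `one-side` and `hook` make it
    -- `minus`. If it has a neighbour `w` in `One (4 + m)`, it is `minus` by `hook′` and because an
    -- edge to `One m` would close a triangle with `w`. Otherwise it is `plus`.
    two-kind : ∀ m {v} → Two (1 + m) v → Kind plus m v ⊎ Kind minus (4 + m) v
    two-kind m {v} v₂ with any? (λ x → two? m x ×-dec ¬? (v ~? x))
    ... | yes (x , x₂ , v≁x) = inj₂ (v₂ ,
      (λ y y₂ → stable λ v≁y → one-side (2 + m) v₂ y₂ x₂ v≁y v≁x) ,
      (λ w w₁ → hook m v₂ x₂ w₁ v≁x))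
    ... | no complete with any? (λ w → one? (4 + m) w ×-dec v ~? w)
    ...   | yes (w , w₁ , vw) = inj₂ (v₂ ,
      (λ y y₂ → stable λ v≁y → hook′ (4 + m) v₂ y₂ w₁ v≁y vw) ,
      (λ w′ w′₁ vw′ → △ vw vw′ (one-one (4 + m) w₁ w′₁)))
    ...   | no anti = inj₁ (v₂ ,
      (λ x x₂ → stable λ v≁x → complete (x , x₂ , v≁x)) ,
      (λ w w₁ vw → anti (w , w₁ , vw)))

    Near : Pred (Fin n) 0ℓ
    Near v = ∃ λ (i : Fin 5) → v ~ corner (toℕ i)

    near? : Decidable Near
    near? v = any? λ i → v ~? corner (toℕ i)

    reduce : ∀ m → ∃ λ (i : Fin 5) → (∀ {v} → v ~ corner m → v ~ corner (toℕ i)) ×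
                                     (∀ {κ v} → Kind κ m v → Kind κ (toℕ i) v)
    reduce 0 = 0F , id , id
    reduce 1 = 1F , id , id
    reduce 2 = 2F , id , id
    reduce 3 = 3F , id , id
    reduce 4 = 4F , id , id
    reduce (suc (suc (suc (suc (suc m))))) =
      -- `Kind κ` computes only for a concrete `κ`, hence the three equal cases.
      let i , near , kind = reduce m in i , near , λ { {plus} → kind {plus} ; {pend} → kind {pend} ; {minus} → kind {minus} }

    abstract

      kinds : ∀ {v} → Near v → ∃₂ λ (i : Fin 5) κ → Kind κ (toℕ i) v
      kinds {v} (i , near) = locate (toℕ i) near (two? (toℕ i) v) (two? (3 + toℕ i) v)
        where
        at : ∀ κ m → Kind κ m v → ∃₂ λ (i : Fin 5) κ → Kind κ (toℕ i) v
        at κ m v∈ = let j , _ , kind = reduce m in j , κ , kind {κ} v∈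

        locate : ∀ m → v ~ corner m → Dec (Two m v) → Dec (Two (3 + m) v) →
                 ∃₂ λ (i : Fin 5) κ → Kind κ (toℕ i) v
        -- The offset four turns the `Two (1 + m)` of `two-kind` into `Two (5 + m)`, which is
        -- `Two m`.
        locate m v0 (yes v₂) _         = [ at plus (4 + m) , at minus (3 + m) ]′ (two-kind (4 + m) v₂)
        locate m v0 (no _)   (yes v₂)  = [ at plus (2 + m) , at minus (1 + m) ]′ (two-kind (2 + m) v₂)
        locate m v0 (no ¬v₂) (no ¬v₂′) = at pend m (v0 , (λ v2 → ¬v₂ (v0 , v2)) , λ v3 → ¬v₂′ (v3 , v0))

      -- A vertex hanging on `v` beyond the pentagon completes a long leg; the other two legs run
      -- along the cycle in both directions from `corner (2 + m)`.
      far≁two : ∀ m {v x} → (∀ m → x ≁ corner m) → Two m v → x ≁ v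
      far≁two m {v} x≁ v₂@(v0 , v2) xv =
        spider (symm (side (1 + m))) (symm v2) (symm xv) (side (2 + m)) (side (3 + m))
          (flip (x≁ (1 + m))) (flip (chord (4 + m))) (two≁″ {m} v₂) (flip (x≁ (3 + m))) (x≁ (4 + m))

      far≁one : ∀ m {w x} → (∀ m → x ≁ corner m) → One m w → x ≁ w
      far≁one m {w} x≁ (w0 , _ , w≁3) xw =
        spider (side m) (symm w0) (symm xw) (symm (side (4 + m))) (symm (side (3 + m)))
          (flip (x≁ (1 + m))) (chord (1 + m)) w≁3 (flip (x≁ (4 + m))) (x≁ (3 + m))

      near-far : ∀ {s t} → Near s → ¬ Near t → s ≁ t
      near-far {s} {t} near far st = separate (kinds near)
        where
        t≁ : ∀ m → t ≁ corner m
        t≁ m tm = let i , near , _ = reduce m in far (i , near tm)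

        separate : ¬ ∃₂ λ (i : Fin 5) κ → Kind κ (toℕ i) s
        separate (i , plus , s₂ , _) = far≁two (1 + toℕ i) t≁ s₂ (symm st)
        separate (i , pend , s₁)     = far≁one (toℕ i) t≁ s₁ (symm st)
        separate (i , minus , s₂ , _) = far≁two (2 + toℕ i) t≁ s₂ (symm st)

    -- Adjacency between and within the groups

    Uniform : (A B : Pred (Fin n) 0ℓ) → Set
    Uniform A B = (∀ {x y} → A x → B y → x ~ y) ⊎ (∀ {x y} → A x → B y → x ≁ y)

    uniform-sym : ∀ {A B} → Uniform A B → Uniform B A
    uniform-sym = Sum.map (λ f y x → symm (f x y)) (λ f y x → flip (f x y))

    uniform₀ : ∀ m κ → Uniform (Kind κ m) (Kind κ m)
    uniform₀ m plus = inj₂ λ ((x1 , _) , _) ((y1 , _) , _) → share {1 + m} x1 y1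
    uniform₀ m pend = inj₂ λ (x0 , _) (y0 , _) → share {m} x0 y0
    uniform₀ m minus = inj₂ λ ((x2 , _) , _) ((y2 , _) , _) → share {2 + m} x2 y2

    uniform₁ : ∀ m κ κ′ → Uniform (Kind κ m) (Kind κ′ (1 + m))
    uniform₁ m plus plus = inj₁ λ (x₂ , _) (_ , complete , _) → symm (complete _ x₂)
    uniform₁ m plus pend = inj₂ λ ((x1 , _) , _) (y1 , _) → share {1 + m} x1 y1
    uniform₁ m plus minus = inj₂ λ ((_ , x3) , _) ((y3 , _) , _) → share {3 + m} x3 y3
    uniform₁ m pend plus = inj₂ λ x₁ (_ , _ , anti) → flip (anti _ x₁)
    uniform₁ m pend pend = inj₁ (one-one m)
    uniform₁ m pend minus = inj₂ λ (x0 , _) ((_ , y0) , _) → share {m} x0 y0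
    uniform₁ m minus plus = inj₂ λ ((x2 , _) , _) ((y2 , _) , _) → share {2 + m} x2 y2
    uniform₁ m minus pend = inj₂ λ (_ , _ , anti) y₁ → anti _ y₁
    uniform₁ m minus minus = inj₁ λ (_ , complete , _) (y₂ , _) → complete _ y₂

    uniform₂ : ∀ m κ κ′ → Uniform (Kind κ m) (Kind κ′ (2 + m))
    uniform₂ m plus plus = inj₂ λ ((_ , x3) , _) ((y3 , _) , _) → share {3 + m} x3 y3
    uniform₂ m plus pend = inj₁ λ (x₂ , _) y₁ → symm (one-two (2 + m) y₁ x₂)
    uniform₂ m plus minus = inj₂ λ ((x1 , _) , _) ((_ , y1) , _) → share {1 + m} x1 y1
    uniform₂ m pend plus = inj₂ λ (x0 , _) ((_ , y0) , _) → share {m} x0 y0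
    uniform₂ m pend pend = inj₂ (one-one′ m)
    uniform₂ m pend minus = inj₁ λ x₁ (y₂ , _) → one-two m x₁ y₂
    uniform₂ m minus plus = inj₁ λ (x₂ , _) (_ , complete , _) → symm (complete _ x₂)
    uniform₂ m minus pend = inj₂ λ ((x2 , _) , _) (y2 , _) → share {2 + m} x2 y2
    uniform₂ m minus minus = inj₂ λ ((_ , x4) , _) ((y4 , _) , _) → share {4 + m} x4 y4

    periodic : ∀ κ {m v} → Kind κ m v → Kind κ (5 + m) v
    periodic plus h = h
    periodic pend h = h
    periodic minus h = h

    uniform-period : ∀ {m κ} {B : Pred (Fin n) 0ℓ} → Uniform B (Kind κ (5 + m)) → Uniform B (Kind κ m)
    uniform-period {κ = κ} = Sum.map (λ f x y → f x (periodic κ y)) (λ f x y → f x (periodic κ y))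

    uniform-shift : ∀ m (d : Fin 4) κ κ′ → Uniform (Kind κ m) (Kind κ′ (suc (toℕ d) + m))
    uniform-shift m 0F κ κ′ = uniform₁ m κ κ′
    uniform-shift m 1F κ κ′ = uniform₂ m κ κ′
    -- Three or four steps forward are two or one steps backward.
    uniform-shift m 2F κ κ′ = uniform-sym (uniform-period {m} {κ} (uniform₂ (3 + m) κ′ κ))
    uniform-shift m 3F κ κ′ = uniform-sym (uniform-period {m} {κ} (uniform₁ (4 + m) κ′ κ))

    uniform : ∀ {i j} → i ≢ j → ∀ κ κ′ → Uniform (Kind κ (toℕ i)) (Kind κ′ (toℕ j))
    uniform {i} {j} i≢j κ κ′ with offset i j
      where
      offset : ∀ (i j : Fin 5) → i ≡ j ⊎ ∃ λ (d : Fin 4) →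
               suc (toℕ d) + toℕ i ≡ toℕ j ⊎ suc (toℕ d) + toℕ i ≡ 5 + toℕ j
      offset = toWitness {a? = all? λ i → all? λ j → i ≟ j ⊎-dec any? λ d →
        (suc (toℕ d) + toℕ i ℕ.≟ toℕ j) ⊎-dec (suc (toℕ d) + toℕ i ℕ.≟ 5 + toℕ j)} _
    ... | inj₁ i≡j             = contradiction i≡j i≢j
    ... | inj₂ (d , inj₁ eq) = subst (λ m → Uniform (Kind κ (toℕ i)) (Kind κ′ m)) eq (uniform-shift (toℕ i) d κ κ′)
    ... | inj₂ (d , inj₂ eq) = uniform-period {toℕ j} {κ′}
      (subst (λ m → Uniform (Kind κ (toℕ i)) (Kind κ′ m)) eq (uniform-shift (toℕ i) d κ κ′))

    chain : ∀ m {κ κ′} → Next κ κ′ → ∀ {x x′ y y′} → Kind κ m x → Kind κ m x′ → Kind κ′ m y → Kind κ′ m y′ →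
            x ~ y → x′ ~ y′ → x ≁ y′ → x′ ≁ y → ⊥
    chain m plus→pend (x , _) (x′ , _) y y′ xy x′y′ x≁y′ x′≁y = chain-one m x x′ y y′ xy x′y′ x≁y′ x′≁y
    chain m pend→minus x x′ (y , _) (y′ , _) xy x′y′ x≁y′ x′≁y = chain-one′ m x x′ y y′ xy x′y′ x≁y′ x′≁y
    chain m minus→plus (x , _) (x′ , _) (y , _) (y′ , _) xy x′y′ x≁y′ x′≁y =
      chain-two m y y′ x x′ (symm xy) (symm x′y′) (flip x′≁y) (flip x≁y′)

    -- Going round plus, pend, minus, let x beat y if y follows x and is adjacent to it, or precedes x
    -- and is not adjacent to it. Excluding triangles and independent triples excludes 3-cycles.

    Beats : Fin 3 → Fin 3 → Fin n → Fin n → Set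
    Beats κ κ′ x y = (Next κ κ′ × x ~ y) ⊎ (Next κ′ κ × x ≁ y)

    beats? : ∀ κ κ′ x y → Dec (Beats κ κ′ x y)
    beats? κ κ′ x y = (next? κ κ′ ×-dec x ~? y) ⊎-dec (next? κ′ κ ×-dec ¬? (x ~? y))

    beats-total : ∀ {κ κ′} x y → κ ≢ κ′ → Beats κ κ′ x y ⊎ Beats κ′ κ y x
    beats-total x y ne with next-total ne | x ~? y
    ... | inj₁ κκ′ | yes xy = inj₁ (inj₁ (κκ′ , xy))
    ... | inj₁ κκ′ | no x≁y = inj₂ (inj₂ (κκ′ , flip x≁y))
    ... | inj₂ κ′κ | yes xy = inj₂ (inj₁ (κ′κ , symm xy))
    ... | inj₂ κ′κ | no x≁y = inj₁ (inj₂ (κ′κ , x≁y))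

    beats-trans : ∀ m {κ κ′ κ″ x y z} → Kind κ m x → Kind κ′ m y → Kind κ″ m z → κ ≢ κ″ →
                  Beats κ κ′ x y → Beats κ′ κ″ y z → Beats κ κ″ x z
    beats-trans m _ _ _ _ (inj₁ (plus→pend , xy)) (inj₁ (pend→minus , yz)) = inj₂ (minus→plus , △ (symm xy) yz)
    beats-trans m _ _ _ _ (inj₁ (pend→minus , xy)) (inj₁ (minus→plus , yz)) = inj₂ (plus→pend , △ (symm xy) yz)
    beats-trans m _ _ _ _ (inj₁ (minus→plus , xy)) (inj₁ (plus→pend , yz)) = inj₂ (pend→minus , △ (symm xy) yz)
    beats-trans m _ _ _ ne (inj₁ (plus→pend , _)) (inj₂ (plus→pend , _)) = contradiction refl ne
    beats-trans m _ _ _ ne (inj₁ (pend→minus , _)) (inj₂ (pend→minus , _)) = contradiction refl ne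
    beats-trans m _ _ _ ne (inj₁ (minus→plus , _)) (inj₂ (minus→plus , _)) = contradiction refl ne
    beats-trans m _ _ _ ne (inj₂ (plus→pend , _)) (inj₁ (plus→pend , _)) = contradiction refl ne
    beats-trans m _ _ _ ne (inj₂ (pend→minus , _)) (inj₁ (pend→minus , _)) = contradiction refl ne
    beats-trans m _ _ _ ne (inj₂ (minus→plus , _)) (inj₁ (minus→plus , _)) = contradiction refl ne
    beats-trans m x (y , _) (z , _) _ (inj₂ (plus→pend , x≁y)) (inj₂ (minus→plus , y≁z)) =
      inj₁ (pend→minus , stable λ x≁z → no-independent m y x z (flip x≁y) x≁z y≁z)
    beats-trans m (x , _) y (z , _) _ (inj₂ (pend→minus , x≁y)) (inj₂ (plus→pend , y≁z)) =
      inj₁ (minus→plus , stable λ x≁z → no-independent m z y x (flip y≁z) (flip x≁y) (flip x≁z))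
    beats-trans m (x , _) (y , _) z _ (inj₂ (minus→plus , x≁y)) (inj₂ (pend→minus , y≁z)) =
      inj₁ (plus→pend , stable λ x≁z → no-independent m x z y x≁z (flip y≁z) x≁y)

    next-asym : ∀ {κ κ′} → Next κ κ′ → ¬ Next κ′ κ
    next-asym plus→pend ()
    next-asym pend→minus ()
    next-asym minus→plus ()

    beats-no-square : ∀ m {κ κ′ x y x′ y′} → Kind κ m x → Kind κ′ m y → Kind κ m x′ → Kind κ′ m y′ →
      Beats κ κ′ x y → Beats κ′ κ y x′ → Beats κ κ′ x′ y′ → Beats κ′ κ y′ x → ⊥
    beats-no-square m kx ky kx′ ky′ (inj₁ (κ , xy)) (inj₂ (_ , y≁x′)) (inj₁ (_ , x′y′)) (inj₂ (_ , y′≁x)) =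
      chain m κ kx kx′ ky ky′ xy x′y′ (flip y′≁x) (flip y≁x′)
    beats-no-square m kx ky kx′ ky′ (inj₂ (κ , x≁y)) (inj₁ (_ , yx′)) (inj₂ (_ , x′≁y′)) (inj₁ (_ , y′x)) =
      chain m κ ky ky′ kx′ kx yx′ y′x (flip x≁y) (flip x′≁y′)
    beats-no-square m _ _ _ _ (inj₁ (κ , _)) (inj₁ (κ′ , _)) _ _ = next-asym κ κ′
    beats-no-square m _ _ _ _ (inj₂ (κ , _)) (inj₂ (κ′ , _)) _ _ = next-asym κ κ′
    beats-no-square m _ _ _ _ (inj₁ (κ , _)) (inj₂ _) (inj₂ (κ′ , _)) _ = next-asym κ κ′
    beats-no-square m _ _ _ _ (inj₂ (κ , _)) (inj₁ _) (inj₁ (κ′ , _)) _ = next-asym κ κ′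
    beats-no-square m _ _ _ _ (inj₁ (κ , _)) (inj₂ _) (inj₁ _) (inj₁ (κ′ , _)) = next-asym κ κ′
    beats-no-square m _ _ _ _ (inj₂ (κ , _)) (inj₁ _) (inj₂ _) (inj₂ (κ′ , _)) = next-asym κ κ′

    abstract

      group : Fin n → Fin 5
      group v with near? v
      ... | yes near = proj₁ (kinds near)
      ... | no _     = 0F

      kind : Fin n → Fin 3
      kind v with near? v
      ... | yes near = proj₁ (proj₂ (kinds near))
      ... | no _     = 0F

      kind-correct : ∀ {v} → Near v → Kind (kind v) (toℕ (group v)) v
      kind-correct {v} near with near? v
      ... | yes near′ = proj₂ (proj₂ (kinds near′))
      ... | no ¬near  = contradiction near ¬near

    -- Five groups times three kinds make fifteen labels, injected into the common sixteen.
    label : Fin n → Fin 16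
    label v = inject₁ (combine (group v) (kind v))

    label-injective : ∀ {x y} → label x ≡ label y → group x ≡ group y × kind x ≡ kind y
    label-injective {x} {y} eq = combine-injective (group x) (kind x) (group y) (kind y) (inject₁-injective eq)

    module _ (S : Subset n) (near : ∀ {v} → v ∈ S → Near v) where

      InGroup : Fin 5 → Pred (Fin n) 0ℓ
      InGroup g v = v ∈ S × group v ≡ g

      inGroup? : ∀ g → Decidable (InGroup g)
      inGroup? g v = v ∈? S ×-dec group v ≟ g

      inGroup-kind : ∀ {g v} → InGroup g v → Kind (kind v) (toℕ g) v
      inGroup-kind (v∈S , refl) = kind-correct (near v∈S)

      strongest : ∀ {v} → v ∈ S → ∃ λ z → z ∈ S ×
        (∀ {y} → y ∈ S → group y ≡ group z → kind y ≢ kind z → Beats (kind z) (kind y) z y)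
      strongest {v} v∈S = pick members (∈-filter⁺ (inGroup? g) (∈-allFin v) (v∈S , refl)) (all-filter (inGroup? g) (allFin n))
        (λ y∈S eq → ∈-filter⁺ (inGroup? g) (∈-allFin _) (y∈S , eq))
        where
        g = group v
        members = filter (inGroup? g) (allFin n)

        square : ∀ {x y x′ y′} → InGroup g x → InGroup g y → InGroup g x′ → InGroup g y′ →
          kind x ≡ kind x′ → kind y ≡ kind y′ → Beats (kind x) (kind y) x y → Beats (kind y) (kind x′) y x′ →
          Beats (kind x′) (kind y′) x′ y′ → Beats (kind y′) (kind x) y′ x → ⊥
        square qx qy qx′ qy′ same same′ xy yx′ x′y′ y′x
          with inGroup-kind qx | inGroup-kind qy | inGroup-kind qx′ | inGroup-kind qy′
        ... | kx | ky | kx′ | ky′ rewrite same | same′ = beats-no-square (toℕ g) kx ky kx′ ky′ xy yx′ x′y′ y′x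

        open Champion (InGroup g) kind (λ x y → Beats (kind x) (kind y) x y) (λ x y → beats? (kind x) (kind y) x y)
          (λ {x} {y} → beats-total x y)
          (λ x y z → beats-trans (toℕ g) (inGroup-kind x) (inGroup-kind y) (inGroup-kind z))
          square
          renaming (champion to winner)

        pick : ∀ xs → v List.∈ xs → All (InGroup g) xs → (∀ {y} → y ∈ S → group y ≡ g → y List.∈ xs) →
               ∃ λ z → z ∈ S × (∀ {y} → y ∈ S → group y ≡ group z → kind y ≢ kind z → Beats (kind z) (kind y) z y)
        pick (x ∷ xs) _ qs all∈ with winner x xs qs
        ... | z , z∈ , best with All.lookup qs z∈
        ...   | z∈S , z∈g = z , z∈S , λ y∈S eq → best (all∈ y∈S (trans eq z∈g))

      -- Towards other groups and its own kind `z` is uniform anyway. In its group it beats the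
      -- other two kinds, which means all adjacent for the kind following its own and all
      -- nonadjacent for the one preceding it.
      homogeneous : ∀ {z} → z ∈ S →
        (∀ {y} → y ∈ S → group y ≡ group z → kind y ≢ kind z → Beats (kind z) (kind y) z y) →
        ∀ {s s′} → s ∈ S → s′ ∈ S → label s ≡ label s′ → s ~ z → s′ ~ z
      homogeneous {z} z∈S best {s} {s′} s∈S s′∈S eq sz =
        go (label-injective eq) (kind-correct (near z∈S)) (kind-correct (near s∈S)) (kind-correct (near s′∈S))
           (best s∈S) (best s′∈S) (group s ≟ group z) (kind s ≟ kind z)
        where
        apply : ∀ {A B} → Uniform A B → A z → B s → B s′ → s′ ~ z
        apply (inj₁ complete) az _  bs′ = symm (complete az bs′)
        apply (inj₂ anti)     az bs _   = contradiction (symm sz) (anti az bs)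

        compare : ∀ {κ κ′} → Beats κ κ′ z s → Beats κ κ′ z s′ → s′ ~ z
        compare (inj₁ (_ , _))   (inj₁ (_ , zs′)) = symm zs′
        compare (inj₁ (κ , _))   (inj₂ (κ′ , _))  = contradiction κ′ (next-asym κ)
        compare (inj₂ (_ , z≁s)) _                = contradiction (symm sz) z≁s

        go : ∀ {g g′ h κ κ′ ι} → g ≡ g′ × κ ≡ κ′ → Kind ι (toℕ h) z → Kind κ (toℕ g) s → Kind κ′ (toℕ g′) s′ →
             (g ≡ h → κ ≢ ι → Beats ι κ z s) → (g′ ≡ h → κ′ ≢ ι → Beats ι κ′ z s′) →
             Dec (g ≡ h) → Dec (κ ≡ ι) → s′ ~ z
        go {κ = κ} {ι = ι} (refl , refl) kz ks ks′ _ _ (no g≢h) _ = apply (uniform (g≢h ∘ sym) ι κ) kz ks ks′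
        go {h = h} {κ = κ} (refl , refl) kz ks ks′ _ _ (yes refl) (yes refl) = apply (uniform₀ (toℕ h) κ) kz ks ks′
        go (refl , refl) kz ks ks′ b b′ (yes refl) (no κ≢ι) = compare (b refl κ≢ι) (b′ refl κ≢ι)

    built-near : ∀ S → Acc _⊂_ S → (∀ {v} → v ∈ S → Near v) → Nonempty S → Built G S label
    built-near S (acc rec) near (v , v∈S) with strongest S near v∈S
    ... | z , z∈S , best with any? (λ x → x ∈? S ×-dec ¬? (x ≟ z))
    ...   | no only = point z z∈S only′
      where
      only′ : ∀ {x} → x ∈ S → x ≡ z
      only′ {x} x∈S with x ≟ z
      ... | yes x≡z = x≡z
      ... | no  x≢z = contradiction (x , x∈S , x≢z) only
    ...   | yes (x , x∈S , x≢z) = subst (λ T → Built G T label) (⊆-antisym ⊆S S⊆)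
      (built-attach (λ z∈ → proj₂ (∈-restrict⁻ S ≢z? z∈) refl)
        (λ s∈ s′∈ → homogeneous S near z∈S best (proj₁ (∈-restrict⁻ S ≢z? s∈)) (proj₁ (∈-restrict⁻ S ≢z? s′∈)))
        (built-near (restrict S ≢z?) (rec (restrict-⊂ S ≢z? z∈S (λ ne → ne refl)))
          (near ∘ proj₁ ∘ ∈-restrict⁻ S ≢z?) (x , ∈-restrict⁺ S ≢z? x∈S x≢z)))
      where
      ≢z? : Decidable (_≢ z)
      ≢z? x = ¬? (x ≟ z)

      ⊆S : ∀ {x} → x ∈ (restrict S ≢z? ∪ₛ z) → x ∈ S
      ⊆S x∈ with ∪ₛ⁻ {S = restrict S ≢z?} x∈
      ... | inj₁ x∈S  = proj₁ (∈-restrict⁻ S ≢z? x∈S)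
      ... | inj₂ refl = z∈S

      S⊆ : ∀ {x} → x ∈ S → x ∈ (restrict S ≢z? ∪ₛ z)
      S⊆ {x} x∈S with x ≟ z
      ... | yes refl = new {S = restrict S ≢z?}
      ... | no  x≢z  = old (∈-restrict⁺ S ≢z? x∈S x≢z)

-- Bounded clique-width

module Bounded (G : Graph) (free : ((｛ S₁₂₂ ｝ ∪ ｛ K₃ ｝) -Free) G) where

  open Forbidden G free
  open Structure G free
  open AroundPentagon G free
  open Building G

  Maximal : Subset n → Fin n → Set
  Maximal U u = ∀ {y} → y ∈ U → (∀ {a} → a ∈ U → u ~ a → y ~ a) → ∀ {a} → a ∈ U → y ~ a → u ~ a

  module _ (U : Subset n) where

    neighbour? : ∀ v → Decidable (λ a → a ∈ U × v ~ a)
    neighbour? v a = a ∈? U ×-dec v ~? a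

    -- Passing to strictly larger neighbourhoods terminates and keeps the neighbours of `v`, so the
    -- resulting `u` still has three.
    maximise : ∀ v → v ∈ U → Acc _⊃_ (select (neighbour? v)) →
               ∃ λ u → u ∈ U × (∀ {a} → a ∈ U → v ~ a → u ~ a) × Maximal U u
    maximise v v∈U (acc rec)
      with any? (λ y → y ∈? U ×-dec all? (λ a → a ∈? U →-dec v ~? a →-dec y ~? a) ×-dec
                       any? λ a → a ∈? U ×-dec y ~? a ×-dec ¬? (v ~? a))
    ... | no none = v , v∈U , (λ _ va → va) , λ {y} y∈U above {a} a∈U ya →
      stable λ v≁a → none (y , y∈U , (λ a → above {a}) , a , a∈U , ya , v≁a)
    ... | yes (y , y∈U , above , a , a∈U , ya , v≁a) =
      let u , u∈U , above′ , max = maximise y y∈U (rec larger) in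
      u , u∈U , (λ a∈U va → above′ a∈U (above _ a∈U va)) , max
      where
      larger : select (neighbour? y) ⊃ select (neighbour? v)
      larger = (λ x∈ → let x∈U , vx = ∈-select⁻ (neighbour? v) x∈ in ∈-select⁺ (neighbour? y) (x∈U , above _ x∈U vx)) ,
        a , ∈-select⁺ (neighbour? y) (a∈U , ya) , v≁a ∘ proj₂ ∘ ∈-select⁻ (neighbour? v)

    separated? : ∀ v v′ → Dec (Separated U v v′)
    separated? v v′ = any? λ z → z ∈? U ×-dec ((z ~? v ×-dec ¬? (z ~? v′)) ⊎-dec (z ~? v′ ×-dec ¬? (z ~? v)))

    data Reduction : Set₁ where
      thin       : (∀ {v a b c} → v ∈ U → a ∈ U → b ∈ U → c ∈ U → v ~ a → v ~ b → v ~ c →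
                    a ≡ b ⊎ a ≡ c ⊎ b ≡ c) → Reduction
      twins      : ∀ {v v′ w} → v ∈ U → v′ ∈ U → w ∈ U → v ≢ v′ → w ~ v → w ~ v′ →
                   ¬ Separated U v v′ → Reduction
      decomposed : ∀ u → Decomposition U u → Reduction

    reduction : PentagonFree U → Reduction
    reduction pentagon-free
      with any? (λ v → any? λ a → any? λ b → any? λ c →
             v ∈? U ×-dec a ∈? U ×-dec b ∈? U ×-dec c ∈? U ×-dec v ~? a ×-dec v ~? b ×-dec v ~? c ×-dec
             ¬? (a ≟ b ⊎-dec a ≟ c ⊎-dec b ≟ c))
    ... | no none = thin λ {v} {a} {b} {c} v∈ a∈ b∈ c∈ va vb vc →
      decidable-stable (a ≟ b ⊎-dec a ≟ c ⊎-dec b ≟ c)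
        λ distinct → none (v , a , b , c , v∈ , a∈ , b∈ , c∈ , va , vb , vc , distinct)
    ... | yes (v , a , b , c , v∈ , a∈ , b∈ , c∈ , va , vb , vc , distinct)
      with any? (λ x → any? λ x′ → any? λ w → x ∈? U ×-dec x′ ∈? U ×-dec w ∈? U ×-dec
                 ¬? (x ≟ x′) ×-dec w ~? x ×-dec w ~? x′ ×-dec ¬? (separated? x x′))
    ...   | yes (x , x′ , w , x∈ , x′∈ , w∈ , ne , wx , wx′ , alike) = twins x∈ x′∈ w∈ ne wx wx′ alike
    ...   | no no-twins = choose (maximise v v∈ (⊃-wellFounded _))
      where
      twin-free : TwinFree U
      twin-free {x} {x′} {w} x∈ x′∈ w∈ ne wx wx′ = decidable-stable (separated? x x′)
        λ alike → no-twins (x , x′ , w , x∈ , x′∈ , w∈ , ne , wx , wx′ , alike)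

      choose : (∃ λ u → u ∈ U × (∀ {a} → a ∈ U → v ~ a → u ~ a) × Maximal U u) → Reduction
      choose (u , u∈ , above , max) = decomposed u
        (Layers.decomposition U pentagon-free twin-free u u∈ outside a∈ b∈ c∈
          (above a∈ va) (above b∈ vb) (above c∈ vc)
          (distinct ∘ inj₁) (distinct ∘ inj₂ ∘ inj₁) (distinct ∘ inj₂ ∘ inj₂))
        where
        outside : ∀ {y} → y ∈ U → y ≢ u → ∃ λ x → (x ∈ U × u ~ x) × y ≁ x
        outside {y} y∈ y≢u with any? (λ x → (x ∈? U ×-dec u ~? x) ×-dec ¬? (y ~? x))
        ... | yes found = found
        -- By maximality `y` and `u` would have equal neighbourhoods, so they would be twins with
        -- common neighbour `a`.
        ... | no none = case twin-free y∈ u∈ a∈ y≢u (symm (covers a∈ (above a∈ va))) (symm (above a∈ va)) of λ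
          { (z , z∈ , inj₁ (zy , z≁u)) → contradiction (symm (max y∈ covers z∈ (symm zy))) z≁u
          ; (z , z∈ , inj₂ (zu , z≁y)) → contradiction (symm (covers z∈ (symm zu))) z≁y }
          where
          covers : ∀ {a} → a ∈ U → u ~ a → y ~ a
          covers a∈ ua = stable λ y≁a → none (_ , (a∈ , ua) , y≁a)

  module _ {k : ℕ} {l : Fin n → Fin k} where

    built-parts : ∀ U {P : Pred (Fin n) 0ℓ} (P? : Decidable P) →
      (∀ {s s′ t t′} → s ∈ U → s′ ∈ U → t ∈ U → t′ ∈ U → P s → P s′ → ¬ P t → ¬ P t′ →
        l s ≡ l s′ → l t ≡ l t′ → s ~ t → s′ ~ t′) →
      Built G (restrict U P?) l → Built G (restrict U (¬? ∘ P?)) l → Built G U l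
    built-parts U P? hom = merge (restrict-partition U P?) λ s s′ t t′ →
      let s∈ , ps = ∈-restrict⁻ U P? s ; s′∈ , ps′ = ∈-restrict⁻ U P? s′
          t∈ , pt = ∈-restrict⁻ U (¬? ∘ P?) t ; t′∈ , pt′ = ∈-restrict⁻ U (¬? ∘ P?) t′
      in hom s∈ s′∈ t∈ t′∈ ps ps′ pt pt′

    Smaller : Subset n → Set
    Smaller U = ∀ {S} → S ⊂ U → Nonempty S → Built G S l

    smaller-parts : ∀ U {P : Pred (Fin n) 0ℓ} (P? : Decidable P) →
      (∀ {s s′ t t′} → s ∈ U → s′ ∈ U → t ∈ U → t′ ∈ U → P s → P s′ → ¬ P t → ¬ P t′ →
        l s ≡ l s′ → l t ≡ l t′ → s ~ t → s′ ~ t′) →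
      ∀ {s t} → s ∈ U → P s → t ∈ U → ¬ P t → Smaller U → Built G U l
    smaller-parts U P? hom s∈ ps t∈ ¬pt ih = built-parts U P? hom
      (ih (restrict-⊂ U P? t∈ ¬pt) (_ , ∈-restrict⁺ U P? s∈ ps))
      (ih (restrict-⊂ U (¬? ∘ P?) s∈ (λ ¬ps → ¬ps ps)) (_ , ∈-restrict⁺ U (¬? ∘ P?) t∈ ¬pt))

    remove-twin : ∀ U {v v′} → v ∈ U → v′ ∈ U → v ≢ v′ → ¬ Separated U v v′ → l v′ ≡ l v →
                  Smaller U → Built G U l
    remove-twin U {v} {v′} v∈ v′∈ v≢v′ alike same ih = subst (λ S → Built G S l) (⊆-antisym ⊆U U⊆)
      (built-twin (ih (restrict-⊂ U ≢v′? v′∈ (λ ne → ne refl)) (v , v∈U⁻)) v∈U⁻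
        (λ v′∈ → proj₂ (∈-restrict⁻ U ≢v′? v′∈) refl)
        (λ w∈ vw → stable λ v′≁w → alike (_ , proj₁ (∈-restrict⁻ U ≢v′? w∈) , inj₁ (symm vw , flip v′≁w)))
        (λ w∈ v′w → stable λ v≁w → alike (_ , proj₁ (∈-restrict⁻ U ≢v′? w∈) , inj₂ (symm v′w , flip v≁w)))
        (λ _ → refl) same)
      where
      ≢v′? : Decidable (_≢ v′)
      ≢v′? x = ¬? (x ≟ v′)

      v∈U⁻ : v ∈ restrict U ≢v′?
      v∈U⁻ = ∈-restrict⁺ U ≢v′? v∈ v≢v′

      ⊆U : ∀ {x} → x ∈ (restrict U ≢v′? ∪ₛ v′) → x ∈ U
      ⊆U x∈ with ∪ₛ⁻ {S = restrict U ≢v′?} x∈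
      ... | inj₁ x∈U  = proj₁ (∈-restrict⁻ U ≢v′? x∈U)
      ... | inj₂ refl = v′∈

      U⊆ : ∀ {x} → x ∈ U → x ∈ (restrict U ≢v′? ∪ₛ v′)
      U⊆ {x} x∈U with x ≟ v′
      ... | yes refl = new {S = restrict U ≢v′?}
      ... | no  x≢v′ = old (∈-restrict⁺ U ≢v′? x∈U x≢v′)

  proper-pentagon-free : ∀ {U col} → Proper U col → PentagonFree U
  proper-pentagon-free {col = col} proper {a} {b} {c} {d} {e} a∈ b∈ c∈ d∈ e∈ (pentagon ab bc cd de ea) =
    odd (col a) (col b) (col c) (col d) (col e)
      (proper a∈ b∈ ab) (proper b∈ c∈ bc) (proper c∈ d∈ cd) (proper d∈ e∈ de) (proper e∈ a∈ ea)
    where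
    odd : ∀ a b c d e → a ≢ b → b ≢ c → c ≢ d → d ≢ e → e ≢ a → ⊥
    odd false true false true e _ _ _ de ea = ea (¬-not (de ∘ sym))
    odd true false true false e _ _ _ de ea = ea (¬-not (de ∘ sym))
    odd false false _ _ _ ab _ _ _ _ = ab refl
    odd true true _ _ _ ab _ _ _ _ = ab refl
    odd false true true _ _ _ bc _ _ _ = bc refl
    odd true false false _ _ _ bc _ _ _ = bc refl
    odd false true false false _ _ _ cd _ _ = cd refl
    odd true false true true _ _ _ cd _ _ = cd refl

  colour-injective : ∀ {col : Fin n → Bool} {x y} → colour col x ≡ colour col y → col x ≡ col y
  colour-injective {col} {x} {y} eq = bit-injective (combine-injectiveˡ (bit (col x)) _ (bit (col y)) _ eq)

  -- The colouring is fixed once and restricted to every smaller set, so that the parts of a merge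
  -- are labelled consistently.
  built-bipartite : ∀ U → Acc _⊂_ U → ∀ {col} → Proper U col → Nonempty U → Built G U (colour col)
  built-bipartite U (acc rec) {col} proper nonempty = reduce′ (reduction U (proper-pentagon-free proper))
    where
    ih : Smaller U
    ih S⊂U = built-bipartite _ (rec S⊂U) (λ s∈ t∈ → proper (proj₁ S⊂U s∈) (proj₁ S⊂U t∈))

    reduce′ : Reduction U → Built G U (colour col)
    reduce′ (thin at-most-two) = Thin.built-thin G U col at-most-two nonempty
    reduce′ (twins {v} {v′} {w} v∈ v′∈ w∈ ne wv wv′ alike) = remove-twin U v∈ v′∈ ne alike
      (cong (λ b → combine (bit b) (zero {7}))
        (trans (¬-not (proper v′∈ w∈ (symm wv′))) (sym (¬-not (proper v∈ w∈ (symm wv)))))) ih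
    reduce′ (decomposed u (parallel P? s∈ ps t∈ ¬pt apart)) = smaller-parts U P?
      (λ s∈ _ t∈ _ ps _ ¬pt _ _ _ st → contradiction st (apart s∈ t∈ ps ¬pt)) s∈ ps t∈ ¬pt ih
    reduce′ (decomposed u (series {Wh} {Pt} W? P? _ rigid s∈ ps t∈ ¬pt link)) = smaller-parts U P? hom s∈ ps t∈ ¬pt ih
      where
      differ : ∀ {s t} → s ∈ U → t ∈ U → col s ≢ col t → (Wh s × ¬ Wh t) ⊎ (¬ Wh s × Wh t)
      differ {s} {t} s∈ t∈ ne with W? s | W? t
      ... | yes ws | no ¬wt = inj₁ (ws , ¬wt)
      ... | no ¬ws | yes wt = inj₂ (¬ws , wt)
      ... | yes ws | yes wt = contradiction (trans (proj₁ (rigid proper s∈) ws) (sym (proj₁ (rigid proper t∈) wt))) ne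
      ... | no ¬ws | no ¬wt = contradiction (trans (proj₂ (rigid proper s∈) ¬ws) (sym (proj₂ (rigid proper t∈) ¬wt))) ne

      hom : ∀ {s s′ t t′} → s ∈ U → s′ ∈ U → t ∈ U → t′ ∈ U → Pt s → Pt s′ → ¬ Pt t → ¬ Pt t′ →
            colour col s ≡ colour col s′ → colour col t ≡ colour col t′ → s ~ t → s′ ~ t′
      -- An edge shows that the two labels carry different colours, hence different classes by
      -- rigidity; across `P` such vertices are always adjacent.
      hom {s} {s′} {t} {t′} s∈ s′∈ t∈ t′∈ _ ps′ _ ¬pt′ ss′ tt′ st = link s′∈ t′∈ ps′ ¬pt′
        (differ s′∈ t′∈ λ eq → proper s∈ t∈ st
          (trans (colour-injective {col} {s} {s′} ss′) (trans eq (sym (colour-injective {col} {t} {t′} tt′)))))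

  built : ∀ U → Acc _⊂_ U → Nonempty U → Built G {16} U (λ _ → zero)
  built U (acc rec) nonempty
    with any? (λ a → any? λ b → any? λ c → any? λ d → any? λ e →
           a ∈? U ×-dec b ∈? U ×-dec c ∈? U ×-dec d ∈? U ×-dec e ∈? U ×-dec
           a ~? b ×-dec b ~? c ×-dec c ~? d ×-dec d ~? e ×-dec e ~? a)
  ... | no none = reduce′ (reduction U λ a∈ b∈ c∈ d∈ e∈ (pentagon ab bc cd de ea) →
          none (_ , _ , _ , _ , _ , a∈ , b∈ , c∈ , d∈ , e∈ , ab , bc , cd , de , ea))
    where
    ih : Smaller U
    ih S⊂U = built _ (rec S⊂U)

    reduce′ : Reduction U → Built G U (λ _ → zero)
    reduce′ (thin at-most-two) = coarsen (λ _ _ _ → refl) (Thin.built-thin G U (λ _ → true) at-most-two nonempty)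
    reduce′ (twins v∈ v′∈ _ ne _ _ alike) = remove-twin U v∈ v′∈ ne alike refl ih
    reduce′ (decomposed u (parallel P? s∈ ps t∈ ¬pt apart)) = smaller-parts U P?
      (λ s∈ _ t∈ _ ps _ ¬pt _ _ _ st → contradiction st (apart s∈ t∈ ps ¬pt)) s∈ ps t∈ ¬pt ih
    -- One series decomposition shows that `U` is bipartite; the bipartite induction takes over with
    -- `W` as colouring.
    reduce′ (decomposed u (series W? _ bipartite _ _ _ _ _ _)) =
      coarsen (λ _ _ _ → refl) (built-bipartite U (⊂-wellFounded _) {does ∘ W?} proper nonempty)
      where
      proper : Proper U (does ∘ W?)
      proper {s} {t} s∈ t∈ st eq with bipartite s∈ t∈ st
      ... | inj₁ (ws , ¬wt) = case trans (sym (dec-true (W? s) ws)) (trans eq (dec-false (W? t) ¬wt)) of λ ()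
      ... | inj₂ (¬ws , wt) = case trans (sym (dec-false (W? s) ¬ws)) (trans eq (dec-true (W? t) wt)) of λ ()
  ... | yes (a , b , c , d , e , a∈ , _ , _ , _ , _ , ab , bc , cd , de , ea)
    = beyond (any? λ v → v ∈? U ×-dec ¬? (near? cycle v))
    where
    cycle : Pentagon a b c d e
    cycle = pentagon ab bc cd de ea

    a-near : Near cycle a
    a-near = suc zero , ab

    beyond : Dec (∃ λ v → v ∈ U × ¬ Near cycle v) → Built G U (λ _ → zero)
    beyond (no all-near) = coarsen (λ _ _ _ → refl)
      (built-near cycle U (⊂-wellFounded _)
        (λ {v} v∈ → decidable-stable (near? cycle v) λ far → all-near (v , v∈ , far)) nonempty)
    -- The vertices near the pentagon have no neighbours among the rest, so they are built on their
    -- own and the rest by induction.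
    beyond (yes (v , v∈ , far)) = built-parts U (near? cycle)
      (λ s∈ _ t∈ _ ps _ ¬pt _ _ _ st → contradiction st (near-far cycle ps ¬pt))
      (coarsen (λ _ _ _ → refl) (built-near cycle _ (⊂-wellFounded _)
        (proj₂ ∘ ∈-restrict⁻ U (near? cycle)) (a , ∈-restrict⁺ U (near? cycle) a∈ a-near)))
      (built _ (rec (restrict-⊂ U (¬? ∘ near? cycle) a∈ (λ far → far a-near)))
        (v , ∈-restrict⁺ U (¬? ∘ near? cycle) v∈ far))

  -- Sixteen labels in two copies give thirty-two.
  constructible : Constructible G 32
  constructible = Sum.map id (λ nonempty → built⇒≅ G (λ _ → ∈⊤) (built full (⊂-wellFounded _) nonempty)) (full? n)
    where
    full? : ∀ m → m ≡ 0 ⊎ Nonempty {m} full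
    full? zero    = inj₁ refl
    full? (suc m) = inj₂ (zero , ∈⊤)

theorem2 : BoundedCliqueWidth ((｛ S₁₂₂ ｝ ∪ ｛ K₃ ｝) -Free)
theorem2 = 32 , λ G free → proj₂ (cw-isMinimum G) 32 (Bounded.constructible G free)
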